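{- A strict independence relation has weak canonical bases if and only if it is canonical. Moreover, if $\perp$ is a canonical independence relation and $B$ is an algebraically closed set, then the weak canonical base of a type $\operatorname{tp}(\bar a/B)$ is $\operatorname{aker}(\bar a_i)_{i<\omega}$, where $(\bar a_i)_{i<\omega}$ is an arbitrary $\perp$-Morley sequence for $\operatorname{tp}(\bar a/B)$.
   Context: $T$ is a complete consistent first-order theory (possibly many-sorted, e.g. of the form $T^{\mathrm{eq}}$); we work in a big saturated model of $T$. All sets are small subsets of the big model; $BC$ means $B\cup C$; $\operatorname{acl}$ is algebraic closure; tuples may be infinite and also denote the sets of their entries. $A\equiv_BA'$ means that some automorphism fixing $B$ pointwise maps the set $A$ onto $A'$; $(A,B,C)\equiv(A',B',C')$ means that some automorphism maps $A,B,C$ onto $A',B',C'$ respectively. An independence relation is a ternary relation $\perp$ between small sets satisfying: - (invariance) If $A\perp_CB$ and $(A',B',C')\equiv(A,B,C)$, then $A'\perp_{C'}B'$. - (monotonicity) If $A\perp_CB$, $A'\subseteq A$, $B'\subseteq B$, then $A'\perp_CB'$. - (base monotonicity) If $D\subseteq C\subseteq B$ and $A\perp_DB$, then $A\perp_CB$. - (transitivity) If $D\subseteq C\subseteq B$, $B\perp_CA$ and $C\perp_DA$, then $B\perp_DA$. - (normality) $A\perp_CB$ implies $AC\perp_CB$. - (extension) If $A\perp_CB$ and $\hat B\supseteq B$, then there is $A'\equiv_{BC}A$ with $A'\perp_C\hat B$. - (finite character) If $A_0\perp_CB$ for all finite $A_0\subseteq A$, then $A\perp_CB$. - (local character) For every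 $A$ there is a cardinal $\kappa(A)$ such that for any $B$ there is $C\subseteq B$ with $|C|<\kappa(A)$ and $A\perp_CB$. It is strict if moreover (anti-reflexivity) $a\perp_Ba$ implies $a\in\operatorname{acl}B$. It is canonical if it is strict and has the intersection property: whenever $C_1\subseteq B$ and $C_2\subseteq B$ are such that $A\perp_{C_1}B$ and $A\perp_{C_2}B$, then $A\perp_{\operatorname{acl}C_1\cap\operatorname{acl}C_2}B$. Weak canonical bases: for a tuple $\bar a$ and $B=\operatorname{acl}B$, an algebraically closed set $C\subseteq B$ is the weak canonical base (with respect to $\perp$) of $\operatorname{tp}(\bar a/B)$ if $C$ is the smallest algebraically closed subset of $B$ such that $\bar a\perp_CB$ (i.e. $\bar a\perp_CB$, and $C\subseteq D$ for every algebraically closed $D\subseteq B$ with $\bar a\perp_DB$). $\perp$ has weak canonical bases if $\operatorname{tp}(\bar a/B)$ has a weak canonical base for every tuple $\bar a$ and every algebraically closed set $B$. A $\perp$-Morley sequence for $p\in S(B)$ is a sequence of $B$-indiscernibles $(\bar a_i)_{i<\omega}$, each realising $p$, such that $(\bar a_i)_{i<n}\perp_B\bar a_n$ for every $n<\omega$. The algebraic kernel of a sequence of indiscernibles $(\bar a_i)_{i\in I}$ is $\operatorname{aker}(\bar a_i)_{i\in I}=\{d\mid d\in\operatorname{acl}(\{\bar a_i\mid i\in I\})\text{ and }(\bar a_i)_{i\in I}\text{ is indiscernible over }d\}$. -}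

module Defs where

open import Level using (Level; _⊔_) renaming (suc to lsuc)
open import Data.Empty.Polymorphic using (⊥)
open import Data.Fin using (Fin) renaming (_<_ to _<ᶠ_)
open import Data.List using (List; []; _∷_; _++_; map)
open import Data.List.Membership.Propositional using () renaming (_∈_ to _∈ˡ_)
open import Data.List.Relation.Unary.All as All using (All; []; _∷_)
open import Data.List.Relation.Unary.All.Properties using (++⁺)
open import Data.Nat using (ℕ; _<_)
open import Data.Product using (Σ; ∃; ∃-syntax; _×_; _,_; proj₁; proj₂)
open import Data.Sum using (_⊎_)
open import Data.Unit using (⊤)
open import Function.Bundles using (_⇔_; _↔_; module Inverse)
open import Relation.Binary.PropositionalEquality using (_≡_)
open import Relation.Binary.Core using (_Preserves_⟶_)
open import Relation.Nullary using (¬_)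
open import Relation.Unary using (Pred; _∈_; _⊆_; _≐_; _∪_; _∩_; ｛_｝)

record Signature (ℓ : Level) : Set (lsuc ℓ) where
  field
    Sort Fun Rel : Set ℓ
    dom   : Fun → List Sort
    cod   : Fun → Sort
    arity : Rel → List Sort

module _ {ℓ : Level} (L : Signature ℓ) where
  open Signature L

  data Term (Γ : List Sort) : Sort → Set ℓ where
    var : ∀ {s} → s ∈ˡ Γ → Term Γ s
    fun : (f : Fun) → All (Term Γ) (dom f) → Term Γ (cod f)

  -- The other connectives and ∃ are the usual classical abbreviations.
  data Formula (Γ : List Sort) : Set ℓ where
    rel  : (R : Rel) → All (Term Γ) (arity R) → Formula Γ
    eq   : ∀ {s} → Term Γ s → Term Γ s → Formula Γ
    fls  : Formula Γ
    _⇒_  : Formula Γ → Formula Γ → Formula Γ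
    all′ : (s : Sort) → Formula (s ∷ Γ) → Formula Γ

  Sentence : Set ℓ
  Sentence = Formula []

  Theory : Set (lsuc ℓ)
  Theory = Pred Sentence ℓ

  -- Structures live one universe above the language: the types in Set ℓ play
  -- the role of the small sets (see Small below).
  record Structure : Set (lsuc (lsuc ℓ)) where
    field
      Carrier   : Sort → Set (lsuc ℓ)
      inhabited : ∀ s → Carrier s
      ⟦_⟧ᶠ      : (f : Fun) → All Carrier (dom f) → Carrier (cod f)
      ⟦_⟧ʳ      : (R : Rel) → All Carrier (arity R) → Set (lsuc ℓ)

module _ {ℓ : Level} {L : Signature ℓ} (M : Structure L) where
  open Signature L
  open Structure M

  ⟦_⟧  : ∀ {Γ s} → Term L Γ s → All Carrier Γ → Carrier s
  ⟦_⟧* : ∀ {Γ ss} → All (Term L Γ) ss → All Carrier Γ → All Carrier ss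
  ⟦ var x ⟧ ρ     = All.lookup ρ x
  ⟦ fun f ts ⟧ ρ  = ⟦ f ⟧ᶠ (⟦ ts ⟧* ρ)
  ⟦ [] ⟧* ρ       = []
  ⟦ t ∷ ts ⟧* ρ   = ⟦ t ⟧ ρ ∷ ⟦ ts ⟧* ρ

  Sat : ∀ {Γ} → Formula L Γ → All Carrier Γ → Set (lsuc ℓ)
  Sat (rel R ts)  ρ = ⟦ R ⟧ʳ (⟦ ts ⟧* ρ)
  Sat (eq t u)    ρ = ⟦ t ⟧ ρ ≡ ⟦ u ⟧ ρ
  Sat fls         ρ = ⊥
  Sat (φ ⇒ ψ)     ρ = Sat φ ρ → Sat ψ ρ
  Sat (all′ s φ)  ρ = (x : Carrier s) → Sat φ (x ∷ ρ)

  Models : Theory L → Set (lsuc ℓ)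
  Models T = ∀ {φ} → φ ∈ T → Sat φ []

module _ {ℓ : Level} {L : Signature ℓ} (T : Theory L) where

  -- Consistency and entailment are semantic.  By Löwenheim–Skolem it does not
  -- matter in which universe (at or above that of L) the models are taken.
  Entails : Sentence L → Set (lsuc (lsuc ℓ))
  Entails φ = (N : Structure L) → Models N T → Sat N φ []

  Consistent : Set (lsuc (lsuc ℓ))
  Consistent = Σ (Structure L) λ N → Models N T

  Complete : Set (lsuc (lsuc ℓ))
  Complete = (φ : Sentence L) → Entails φ ⊎ Entails (φ ⇒ fls)

module _ {ℓ : Level} {L : Signature ℓ} (M : Structure L) where
  open Signature L
  open Structure M

  -- An element of M together with its sort.
  Elem : Set (lsuc ℓ)
  Elem = Σ Sort Carrier

  Subset : Set (lsuc (lsuc ℓ))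
  Subset = Pred Elem (lsuc ℓ)

  Small : Subset → Set (lsuc ℓ)
  Small A = Σ (Set ℓ) λ I → Σ (I → Elem) λ f → ∀ {x} → x ∈ A → ∃[ i ] f i ≡ x

  -- Possibly infinite tuples whose i-th entry has sort σ i.
  Tuple : ∀ {i} {I : Set i} → (I → Sort) → Set (i ⊔ lsuc ℓ)
  Tuple σ = ∀ i → Carrier (σ i)

  range : ∀ {I : Set ℓ} {σ : I → Sort} → Tuple σ → Subset
  range {σ = σ} a x = ∃[ i ] (σ i , a i) ≡ x

  select : ∀ {i} {I : Set i} {σ : I → Sort} →
           Tuple σ → (is : List I) → All Carrier (map σ is)
  select a []       = []
  select a (i ∷ is) = a i ∷ select a is

  -- A formula in finitely many of the variables (xᵢ)_{i∈I}, xᵢ of sort σ i,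
  -- with parameters from B.
  record FormulaOver (B : Subset) {i} {I : Set i} (σ : I → Sort)
         : Set (i ⊔ lsuc ℓ) where
    field
      vars    : List I
      params  : List Elem
      params∈ : All (_∈ B) params
      formula : Formula L (map σ vars ++ map proj₁ params)

  Holds : ∀ {B : Subset} {i} {I : Set i} {σ : I → Sort} →
          FormulaOver B σ → Tuple σ → Set (lsuc ℓ)
  Holds φ a = Sat M formula (++⁺ (select a vars) (select proj₂ params))
    where open FormulaOver φ

  -- tp(a/B) = tp(a′/B)
  SameType : Subset → ∀ {i} {I : Set i} {σ : I → Sort} →
             Tuple σ → Tuple σ → Set (i ⊔ lsuc ℓ)
  SameType B {σ = σ} a a′ = (φ : FormulaOver B σ) → Holds φ a ⇔ Holds φ a′

  acl : Subset → Subset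
  acl B (s , x) =
    Σ (FormulaOver B {I = ⊤} (λ _ → s)) λ φ →
      Holds φ (λ _ → x) ×
      (Σ (List (Carrier s)) λ xs → ∀ y → Holds φ (λ _ → y) → y ∈ˡ xs)

  AclClosed : Subset → Set (lsuc ℓ)
  AclClosed B = B ≐ acl B

  record Automorphism : Set (lsuc ℓ) where
    field
      perm : ∀ s → Carrier s ↔ Carrier s
    to : ∀ {s} → Carrier s → Carrier s
    to {s} = Inverse.to (perm s)
    field
      to-fun : ∀ f xs → to (⟦ f ⟧ᶠ xs) ≡ ⟦ f ⟧ᶠ (All.map to xs)
      to-rel : ∀ R xs → ⟦ R ⟧ʳ xs ⇔ ⟦ R ⟧ʳ (All.map to xs)
    apply : Elem → Elem
    apply (s , x) = s , to x

  open Automorphism using (to; apply)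

  MapsOnto : Automorphism → Subset → Subset → Set (lsuc ℓ)
  MapsOnto α A A′ = (∀ {x} → x ∈ A → apply α x ∈ A′) ×
                    (∀ {y} → y ∈ A′ → ∃[ x ] x ∈ A × apply α x ≡ y)

  -- A ≡_B A′
  Conjugate : Subset → Subset → Subset → Set (lsuc ℓ)
  Conjugate B A A′ =
    Σ Automorphism λ α → (∀ {b} → b ∈ B → apply α b ≡ b) × MapsOnto α A A′

  -- Saturated and StronglyHomogeneous are κ-saturation and strong
  -- κ-homogeneity, with "size < κ" read as Small.  Since tuples may be infinite,
  -- types are taken in any small tuple of variables, not just in one variable.
  Saturated : Set (lsuc (lsuc ℓ))
  Saturated =
    ∀ {B} → Small B → ∀ {I : Set ℓ} {σ : I → Sort}
    (p : Pred (FormulaOver B σ) (lsuc ℓ)) →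
    (∀ φs → All (_∈ p) φs → Σ (Tuple σ) λ c → All (λ φ → Holds φ c) φs) →
    Σ (Tuple σ) λ c → ∀ {φ} → φ ∈ p → Holds φ c

  StronglyHomogeneous : Set (lsuc ℓ)
  StronglyHomogeneous =
    ∀ {I : Set ℓ} {σ : I → Sort} (a a′ : Tuple σ) → SameType (λ _ → ⊥) a a′ →
    Σ Automorphism λ α → ∀ i → to α (a i) ≡ a′ i

  -- |C| < |K|: C embeds into K but K does not embed into C.  The first map may
  -- depend on the proof of x ∈ C, which is harmless given its injectivity on
  -- underlying elements.
  infix 4 _≺_
  _≺_ : Subset → Set ℓ → Set (lsuc ℓ)
  C ≺ K =
    (Σ (∀ x → x ∈ C → K) λ g → ∀ {x y} p q → g x p ≡ g y q → x ≡ y) ×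
    ¬ (Σ (K → Elem) λ f → (∀ k → f k ∈ C) × (∀ {k l} → f k ≡ f l → k ≡ l))

record BigModel {ℓ : Level} {L : Signature ℓ} (T : Theory L)
       : Set (lsuc (lsuc ℓ)) where
  field
    structure           : Structure L
    models              : Models structure T
    saturated           : Saturated structure
    stronglyHomogeneous : StronglyHomogeneous structure

-- A ⫝⟨ C ⟩ B is only meaningful for small sets: every axiom is restricted to
-- these, and the values of the relation on other subsets play no role.
-- Smallness is not demanded where it follows: for subsets and automorphic
-- images of small sets, and algebraic closures of small sets.
Ternary : ∀ {ℓ} {L : Signature ℓ} → Structure L → (r : Level) →
          Set (lsuc (lsuc ℓ) ⊔ lsuc r)
Ternary M r = Subset M → Subset M → Subset M → Set r

module _ {ℓ r : Level} {L : Signature ℓ} (M : Structure L)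
         (_⫝⟨_⟩_ : Ternary M r) where
  open Signature L

  record IsIndependence : Set (lsuc (lsuc ℓ) ⊔ r) where
    field
      invariance : ∀ {A B C A′ B′ C′} → Small M A → Small M B → Small M C →
        (α : Automorphism M) →
        MapsOnto M α A A′ → MapsOnto M α B B′ → MapsOnto M α C C′ →
        A ⫝⟨ C ⟩ B → A′ ⫝⟨ C′ ⟩ B′
      monotonicity : ∀ {A B C A′ B′} → Small M A → Small M B → Small M C →
        A ⫝⟨ C ⟩ B → A′ ⊆ A → B′ ⊆ B → A′ ⫝⟨ C ⟩ B′
      baseMonotonicity : ∀ {A B C D} → Small M A → Small M B →
        D ⊆ C → C ⊆ B → A ⫝⟨ D ⟩ B → A ⫝⟨ C ⟩ B
      transitivity : ∀ {A B C D} → Small M A → Small M B →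
        D ⊆ C → C ⊆ B → B ⫝⟨ C ⟩ A → C ⫝⟨ D ⟩ A → B ⫝⟨ D ⟩ A
      normality : ∀ {A B C} → Small M A → Small M B → Small M C →
        A ⫝⟨ C ⟩ B → (A ∪ C) ⫝⟨ C ⟩ B
      extension : ∀ {A B C B̂} → Small M A → Small M C → Small M B̂ →
        A ⫝⟨ C ⟩ B → B ⊆ B̂ →
        Σ (Subset M) λ A′ → Conjugate M (B ∪ C) A′ A × A′ ⫝⟨ C ⟩ B̂
      finiteCharacter : ∀ {A B C} → Small M A → Small M B → Small M C →
        (∀ xs → All (_∈ A) xs → (_∈ˡ xs) ⫝⟨ C ⟩ B) → A ⫝⟨ C ⟩ B
      localCharacter : ∀ {A} → Small M A →
        Σ (Set ℓ) λ κ → ∀ {B} → Small M B →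
        Σ (Subset M) λ C → C ⊆ B × _≺_ M C κ × A ⫝⟨ C ⟩ B

  record IsStrict : Set (lsuc (lsuc ℓ) ⊔ r) where
    field
      isIndependence  : IsIndependence
      antiReflexivity : ∀ {a B} → Small M B → ｛ a ｝ ⫝⟨ B ⟩ ｛ a ｝ → a ∈ acl M B

  record IsCanonical : Set (lsuc (lsuc ℓ) ⊔ r) where
    field
      isStrict     : IsStrict
      intersection : ∀ {A B C₁ C₂} → Small M A → Small M B →
        C₁ ⊆ B → C₂ ⊆ B → A ⫝⟨ C₁ ⟩ B → A ⫝⟨ C₂ ⟩ B →
        A ⫝⟨ acl M C₁ ∩ acl M C₂ ⟩ B

  record IsWeakCanonicalBase {I : Set ℓ} {σ : I → Sort} (a : Tuple M σ)
         (B C : Subset M) : Set (lsuc (lsuc ℓ) ⊔ r) where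
    field
      subset      : C ⊆ B
      aclClosed   : AclClosed M C
      independent : range M a ⫝⟨ C ⟩ B
      smallest    : ∀ {D} → D ⊆ B → AclClosed M D → range M a ⫝⟨ D ⟩ B → C ⊆ D

  HasWeakCanonicalBases : Set (lsuc (lsuc ℓ) ⊔ r)
  HasWeakCanonicalBases =
    ∀ {I : Set ℓ} {σ : I → Sort} (a : Tuple M σ) {B} → Small M B →
    AclClosed M B → Σ (Subset M) λ C → IsWeakCanonicalBase a B C

module _ {ℓ : Level} {L : Signature ℓ} (M : Structure L) where
  open Signature L

  -- The concatenation of the tuples a_{f 0}, …, a_{f (n-1)}.
  concat : ∀ {I : Set ℓ} {σ : I → Sort} → (ℕ → Tuple M σ) →
           ∀ {n} → (Fin n → ℕ) → Tuple M {I = Fin n × I} (λ (_ , i) → σ i)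
  concat a f (k , i) = a (f k) i

  Indiscernible : Subset M → ∀ {I : Set ℓ} {σ : I → Sort} →
                  (ℕ → Tuple M σ) → Set (lsuc ℓ)
  Indiscernible B a =
    ∀ n (f g : Fin n → ℕ) → f Preserves _<ᶠ_ ⟶ _<_ → g Preserves _<ᶠ_ ⟶ _<_ →
    SameType M B (concat a f) (concat a g)

  aker : ∀ {I : Set ℓ} {σ : I → Sort} → (ℕ → Tuple M σ) → Subset M
  aker a d = d ∈ acl M (λ x → ∃[ i ] x ∈ range M (a i)) ×
             Indiscernible ｛ d ｝ a

  record IsMorley {r} (_⫝⟨_⟩_ : Ternary M r) {I : Set ℓ} {σ : I → Sort}
         (a : Tuple M σ) (B : Subset M) (as : ℕ → Tuple M σ)
         : Set (lsuc ℓ ⊔ r) where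
    field
      indiscernible : Indiscernible B as
      realises      : ∀ i → SameType M B a (as i)
      independent   : ∀ n →
        (λ x → ∃[ i ] i < n × x ∈ range M (as i)) ⫝⟨ B ⟩ range M (as n)

-- Given a canonical ⫝ and a Morley sequence (aᵢ) of tp(a/B), its algebraic kernel
-- is B ∩ acl(aᵢ)ᵢ: an element of the kernel is algebraic over two independent
-- segments of the sequence, hence lies in acl B = B.  If a ⫝⟨ D ⟩ B, then the
-- sequence is also independent of B over D, so anti-reflexivity puts the kernel
-- into every algebraically closed such D.  Conversely, stretch the sequence to a
-- long family (c_k).  Local character of B yields a set S of members and a later
-- member c with c ⫝⟨ S ⟩ B, while c ⫝⟨ B ⟩ S; the intersection property gives
-- c ⫝⟨ acl S ∩ B ⟩ B, and acl S ∩ B is contained in the kernel.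
--
-- All this rests on symmetry.  If A ⫝⟨ C ⟩ B, choose an indiscernible sequence of
-- conjugates of A, each independent over C from B and its predecessors, and
-- stretch it along a reversed long order; local character of B and transitivity
-- then give B ⫝⟨ C ⟩ c for a member c.  Since independence is not determined by
-- single formulas, such a sequence must realise types that occur in arbitrarily
-- long free families, which is an Erdős–Rado argument.

module Submission where

open import Defs
open import Level using (Level; _⊔_; Lift; lift; lower) renaming (suc to lsuc)
open import Axiom.ExcludedMiddle using (ExcludedMiddle)
open import Data.Bool using (Bool; false)
import Data.Empty.Polymorphic as ⊥ₚ
open import Data.Fin using (Fin; zero; suc; toℕ; fromℕ<; opposite) renaming (_<_ to _<ᶠ_)
open import Data.Fin.Properties using (toℕ<n; toℕ-fromℕ<; opposite-prop; opposite-involutive)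
open import Data.List using (List; []; _∷_; _++_; map; cartesianProductWith; concatMap; length; lookup)
open import Data.List.Membership.Propositional using () renaming (_∈_ to _∈ˡ_)
open import Data.List.Membership.Propositional.Properties
  using (∈-++⁺ˡ; ∈-++⁺ʳ; ∈-map⁺; ∈-concatMap⁺; ∈-cartesianProductWith⁺)
open import Data.List.Properties using (∷-injective)
open import Data.List.Relation.Unary.All as All using (All; []; _∷_)
open import Data.List.Relation.Unary.All.Properties using (++⁺)
open import Data.List.Relation.Unary.Any as Any using (here; there)
open import Data.List.Relation.Unary.Any.Properties using (lookup-index)
open import Data.Nat as ℕ
  using (ℕ; zero; suc; _<_; _≤_; _+_; s≤s; z≤n; _≟_; _≤′_; ≤′-reflexive; ≤′-step)
open import Data.Nat.Properties
  using (≤-trans; ≤-refl; ≤-antisym; <-irrefl; <-≤-trans; m≤n⇒m<n∨m≡n; ∸-monoʳ-<; m≤m⊔n;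
        m≤n⊔m; m≤m+n; m≤n+m; m<n⇒m<1+n; m≤n⇒m≤1+n; <⇒≱; ≮⇒≥; <⇒≤; +-mono-<-≤; +-monoʳ-<;
        +-comm; m⊓n≤n; m≤n⇒m⊓n≡m; ⊔-lub; ≤⇒≤′)
open import Data.Product using (Σ; ∃-syntax; _×_; _,_; proj₁; proj₂)
open import Data.Product.Properties.WithK using (,-injectiveʳ)
open import Data.Sum as Sum using (_⊎_; inj₁; inj₂)
open import Data.Unit using (⊤; tt)
import Data.Unit.Polymorphic as ⊤ₚ
open import Data.Vec as Vec using (Vec; []; _∷_; tabulate)
open import Data.Vec.Properties using (lookup-map; lookup∘tabulate) renaming (map-∘ to mapᵛ-∘)
open import Data.Vec.Relation.Unary.All as Allᵛ using ([]; _∷_) renaming (All to Allᵛ)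
open import Data.Vec.Relation.Unary.All.Properties using (tabulate⁺)
open import Data.Vec.Relation.Unary.AllPairs using (AllPairs; []; _∷_)
open import Function.Base using (_∘_; id)
open import Function.Bundles using (_⇔_; mk⇔; module Inverse; module Equivalence)
open import Function.Construct.Composition using (_↔-∘_)
open import Function.Construct.Identity using (↔-id)
open import Function.Construct.Symmetry using (↔-sym)
open import Relation.Binary.Core using (Rel; _Preserves_⟶_)
open import Relation.Binary.Definitions using (Reflexive; Transitive)
open import Relation.Binary.PropositionalEquality
  using (_≡_; refl; sym; trans; cong; cong₂; subst; subst₂)
open import Relation.Nullary using (¬_; Dec; yes; no; does; contradiction)
open import Relation.Nullary.Decidable using (decidable-stable; True; toWitness; fromWitness)
open import Relation.Unary using (Pred; _⊆_; _≐_; _∪_; _∩_) renaming (_∈_ to _∈ᴾ_)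

open Equivalence using (to; from)

-- Finite character is an axiom about the left side only. A claim about infinitely many members of a
-- long family is reduced to finitely many, which an automorphism carries to terms of the given
-- ω-sequence; this works only while those members stand on the left. Before symmetry is known, only
-- later terms can stand to the left of an earlier one, hence the reversed order there. A Morley
-- sequence has the earlier terms on the left by definition, so the kernel argument uses the order
-- as it is.
--
-- The extraction meets another obstacle: its limit comes from saturation, which controls formulas
-- but not independence. Freeness of one term, however, involves only that term, its finitely many
-- predecessors and a fixed set. Each initial segment of the limit is conjugate over that set to an
-- initial segment of a genuine free family, so invariance restores what compactness loses. The
-- types of k-tuples are fixed one k at a time, each choice leaving families over all kinds of
-- trees; no tree family has to be homogeneous for every k.

module Renaming {ℓ : Level} {L : Signature ℓ} (M : Structure L) where
  open Signature L
  open Structure M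

  -- Renaming of variables and its effect on satisfaction.

  Ren : List Sort → List Sort → Set ℓ
  Ren Γ Δ = ∀ {s} → s ∈ˡ Γ → s ∈ˡ Δ

  under : ∀ {Γ Δ s} → Ren Γ Δ → Ren (s ∷ Γ) (s ∷ Δ)
  under r (here p)  = here p
  under r (there x) = there (r x)

  renameᵗ  : ∀ {Γ Δ s} → Ren Γ Δ → Term L Γ s → Term L Δ s
  renameᵗˢ : ∀ {Γ Δ ss} → Ren Γ Δ → All (Term L Γ) ss → All (Term L Δ) ss
  renameᵗ r (var x)     = var (r x)
  renameᵗ r (fun f ts)  = fun f (renameᵗˢ r ts)
  renameᵗˢ r []         = []
  renameᵗˢ r (t ∷ ts)   = renameᵗ r t ∷ renameᵗˢ r ts

  rename : ∀ {Γ Δ} → Ren Γ Δ → Formula L Γ → Formula L Δ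
  rename r (rel R ts) = rel R (renameᵗˢ r ts)
  rename r (eq t u)   = eq (renameᵗ r t) (renameᵗ r u)
  rename r fls        = fls
  rename r (φ ⇒ ψ)    = rename r φ ⇒ rename r ψ
  rename r (all′ s φ) = all′ s (rename (under r) φ)

  record Agree {Γ Δ} (r : Ren Γ Δ) (ρ : All Carrier Γ) (η : All Carrier Δ)
         : Set (lsuc ℓ) where
    constructor agree
    field lookups : ∀ {s} (x : s ∈ˡ Γ) → All.lookup η (r x) ≡ All.lookup ρ x
  open Agree

  agree-under : ∀ {Γ Δ} {r : Ren Γ Δ} {ρ η} → Agree r ρ η →
                ∀ {s} (c : Carrier s) → Agree (under r) (c ∷ ρ) (c ∷ η)
  agree-under h c = agree λ { (here refl) → refl ; (there x) → lookups h x }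

  ⟦rename⟧ᵗ : ∀ {Γ Δ s} {r : Ren Γ Δ} {ρ η} → Agree r ρ η →
              (t : Term L Γ s) → ⟦_⟧ M (renameᵗ r t) η ≡ ⟦_⟧ M t ρ
  ⟦rename⟧ᵗˢ : ∀ {Γ Δ ss} {r : Ren Γ Δ} {ρ η} → Agree r ρ η →
               (ts : All (Term L Γ) ss) → ⟦_⟧* M (renameᵗˢ r ts) η ≡ ⟦_⟧* M ts ρ
  ⟦rename⟧ᵗ h (var x)     = lookups h x
  ⟦rename⟧ᵗ h (fun f ts)  = cong ⟦ f ⟧ᶠ (⟦rename⟧ᵗˢ h ts)
  ⟦rename⟧ᵗˢ h []         = refl
  ⟦rename⟧ᵗˢ h (t ∷ ts)   = cong₂ _∷_ (⟦rename⟧ᵗ h t) (⟦rename⟧ᵗˢ h ts)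

  Sat-rename : ∀ {Γ Δ} {r : Ren Γ Δ} {ρ η} → Agree r ρ η →
               (φ : Formula L Γ) → Sat M φ ρ ⇔ Sat M (rename r φ) η
  Sat-rename h (rel R ts) = mk⇔ (subst ⟦ R ⟧ʳ (sym (⟦rename⟧ᵗˢ h ts)))
                                (subst ⟦ R ⟧ʳ (⟦rename⟧ᵗˢ h ts))
  Sat-rename h (eq t u) =
    mk⇔ (λ e → trans (⟦rename⟧ᵗ h t) (trans e (sym (⟦rename⟧ᵗ h u))))
        (λ e → trans (sym (⟦rename⟧ᵗ h t)) (trans e (⟦rename⟧ᵗ h u)))
  Sat-rename h fls = mk⇔ id id
  Sat-rename h (φ ⇒ ψ) =
    mk⇔ (λ k → to (Sat-rename h ψ) ∘ k ∘ from (Sat-rename h φ))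
        (λ k → from (Sat-rename h ψ) ∘ k ∘ to (Sat-rename h φ))
  Sat-rename h (all′ s φ) =
    mk⇔ (λ k c → to (Sat-rename (agree-under h c) φ) (k c))
        (λ k c → from (Sat-rename (agree-under h c) φ) (k c))

  module _ {i} {Q : Set i} {σ : Q → Sort} where

    position : ∀ {vs q} → q ∈ˡ vs → σ q ∈ˡ map σ vs
    position (here refl) = here refl
    position (there p)   = there (position p)

    lookup-position : (x : Tuple M σ) → ∀ {vs q} (p : q ∈ˡ vs) →
                      All.lookup (select M x vs) (position p) ≡ x q
    lookup-position x (here refl) = refl
    lookup-position x (there p)   = lookup-position x p

    assign : ∀ {vs Δ} → (∀ {q} → q ∈ˡ vs → σ q ∈ˡ Δ) → Ren (map σ vs) Δ
    assign {_ ∷ _} f (here refl) = f (here refl)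
    assign {_ ∷ _} f (there y)   = assign (f ∘ there) y

    agree-assign : ∀ {vs Δ} (f : ∀ {q} → q ∈ˡ vs → σ q ∈ˡ Δ)
                   (x : Tuple M σ) (η : All Carrier Δ) →
                   (∀ {q} (p : q ∈ˡ vs) → All.lookup η (f p) ≡ x q) →
                   Agree (assign f) (select M x vs) η
    lookups (agree-assign {_ ∷ _} f x η h) (here refl) = h (here refl)
    lookups (agree-assign {_ ∷ _} f x η h) (there y)   =
      lookups (agree-assign (f ∘ there) x η (h ∘ there)) y

  lookup-++ˡ : ∀ {Γ Δ s} (ρ : All Carrier Γ) (η : All Carrier Δ) (x : s ∈ˡ Γ) →
               All.lookup (++⁺ ρ η) (∈-++⁺ˡ x) ≡ All.lookup ρ x
  lookup-++ˡ (c ∷ ρ) η (here refl) = refl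
  lookup-++ˡ (c ∷ ρ) η (there x)   = lookup-++ˡ ρ η x

  lookup-++ʳ : ∀ {Γ Δ s} (ρ : All Carrier Γ) (η : All Carrier Δ) (x : s ∈ˡ Δ) →
               All.lookup (++⁺ ρ η) (∈-++⁺ʳ Γ x) ≡ All.lookup η x
  lookup-++ʳ []      η x = refl
  lookup-++ʳ (c ∷ ρ) η x = lookup-++ʳ ρ η x

  lookup-subst : ∀ {Γ s s′} (η : All Carrier Γ) (e : s ≡ s′) (x : s ∈ˡ Γ) →
                 All.lookup η (subst (_∈ˡ Γ) e x) ≡ subst Carrier e (All.lookup η x)
  lookup-subst η refl x = refl

  private variable
    i : Level
    Q Q′ : Set i
    σ : Q → Sort
    σ′ : Q′ → Sort

  -- Parameters are treated as further variables: a type over `B` becomes the parameter-free type of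
  -- `x ⊕ β`, with `β` an enumeration of `B`. Homogeneity, which concerns types over the empty set,
  -- then yields automorphisms that fix `B`.
  VFormula : {Q : Set i} → (Q → Sort) → Set (i ⊔ ℓ)
  VFormula {Q = Q} σ = Σ (List Q) λ vs → Formula L (map σ vs)

  _⊨_ : Tuple M σ → VFormula σ → Set (lsuc ℓ)
  x ⊨ (vs , φ) = Sat M φ (select M x vs)

  infix 4 _≼_ _⊨_
  _≼_ : Tuple M σ → Tuple M σ → Set _
  x ≼ y = ∀ φ → x ⊨ φ → y ⊨ φ

  negate : VFormula σ → VFormula σ
  negate (vs , φ) = vs , (φ ⇒ fls)

  -- Sorts are matched by a propositional equation because the maps `g` used below are defined by
  -- cases.
  reindex : (g : Q → Q′) → (∀ q → σ′ (g q) ≡ σ q) → VFormula σ → VFormula σ′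
  reindex {σ′ = σ′} g e (vs , φ) =
    map g vs , rename (assign λ {q} p → subst (_∈ˡ _) (e q) (position {σ = σ′} (∈-map⁺ g p))) φ

  ⊨-reindex : (g : Q → Q′) (e : ∀ q → σ′ (g q) ≡ σ q) (φ : VFormula σ)
              {x : Tuple M σ} {y : Tuple M σ′} →
              (∀ {q} → q ∈ˡ proj₁ φ → subst Carrier (e q) (y (g q)) ≡ x q) →
              x ⊨ φ ⇔ y ⊨ reindex {σ′ = σ′} g e φ
  ⊨-reindex {σ′ = σ′} g e (vs , φ) {x} {y} h =
    Sat-rename (agree-assign _ x (select M y (map g vs)) λ {q} p →
      trans (lookup-subst (select M y (map g vs)) (e q) _)
            (trans (cong (subst Carrier (e q)) (lookup-position {σ = σ′} y (∈-map⁺ g p))) (h p))) φ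

  ≼-reindex : (g : Q → Q′) (e : ∀ q → σ′ (g q) ≡ σ q)
              {x x₁ : Tuple M σ} {y y₁ : Tuple M σ′} →
              (∀ q → subst Carrier (e q) (y (g q)) ≡ x q) →
              (∀ q → subst Carrier (e q) (y₁ (g q)) ≡ x₁ q) →
              y ≼ y₁ → x ≼ x₁
  ≼-reindex g e h h₁ k φ xφ =
    from (⊨-reindex g e φ λ _ → h₁ _) (k (reindex g e φ) (to (⊨-reindex g e φ λ _ → h _) xφ))

  infixr 5 _⊕_ _⊕ˢ_
  _⊕ˢ_ : (Q → Sort) → (Q′ → Sort) → Q ⊎ Q′ → Sort
  (σ ⊕ˢ σ′) (inj₁ q) = σ q
  (σ ⊕ˢ σ′) (inj₂ q) = σ′ q

  _⊕_ : Tuple M σ → Tuple M σ′ → Tuple M (σ ⊕ˢ σ′)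
  (x ⊕ y) (inj₁ q) = x q
  (x ⊕ y) (inj₂ q) = y q

  lefts : List (Q ⊎ Q′) → List Q
  lefts []            = []
  lefts (inj₁ q ∷ vs) = q ∷ lefts vs
  lefts (inj₂ _ ∷ vs) = lefts vs

  rights : List (Q ⊎ Q′) → List Q′
  rights []            = []
  rights (inj₁ _ ∷ vs) = rights vs
  rights (inj₂ q ∷ vs) = q ∷ rights vs

  ∈-lefts : ∀ {q : Q} {vs : List (Q ⊎ Q′)} → inj₁ q ∈ˡ vs → q ∈ˡ lefts vs
  ∈-lefts {vs = inj₁ _ ∷ _} (here refl) = here refl
  ∈-lefts {vs = inj₁ _ ∷ _} (there p)   = there (∈-lefts p)
  ∈-lefts {vs = inj₂ _ ∷ _} (there p)   = ∈-lefts p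

  ∈-rights : ∀ {q : Q′} {vs : List (Q ⊎ Q′)} → inj₂ q ∈ˡ vs → q ∈ˡ rights vs
  ∈-rights {vs = inj₂ _ ∷ _} (here refl) = here refl
  ∈-rights {vs = inj₂ _ ∷ _} (there p)   = there (∈-rights p)
  ∈-rights {vs = inj₁ _ ∷ _} (there p)   = ∈-rights p

  elems : Tuple M σ → List _ → List (Elem M)
  elems {σ = σ} β = map λ j → σ j , β j

  param-position : (β : Tuple M σ) → ∀ {js j} → j ∈ˡ js → σ j ∈ˡ map proj₁ (elems β js)
  param-position β (here refl) = here refl
  param-position β (there p)   = there (param-position β p)

  lookup-param : (β : Tuple M σ) → ∀ {js j} (p : j ∈ˡ js) →
                 All.lookup (select M proj₂ (elems β js)) (param-position β p) ≡ β j
  lookup-param β (here refl) = refl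
  lookup-param β (there p)   = lookup-param β p

  module _ {J : Set ℓ} {τ : J → Sort} (β : Tuple M τ) {B : Subset M}
           (β∈ : ∀ j → (τ j , β j) ∈ᴾ B) where

    private
      all-elems : ∀ js → All (_∈ᴾ B) (elems β js)
      all-elems []       = []
      all-elems (j ∷ js) = β∈ j ∷ all-elems js

      place : ∀ {vs : List (Q ⊎ J)} {v} → v ∈ˡ vs →
              (σ ⊕ˢ τ) v ∈ˡ map σ (lefts vs) ++ map proj₁ (elems β (rights vs))
      place {v = inj₁ q} p = ∈-++⁺ˡ (position (∈-lefts p))
      place {v = inj₂ j} p = ∈-++⁺ʳ _ (param-position β (∈-rights p))

      lookup-place : (x : Tuple M σ) → ∀ {vs : List (Q ⊎ J)} {v} (p : v ∈ˡ vs) →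
        All.lookup (++⁺ (select M x (lefts vs)) (select M proj₂ (elems β (rights vs))))
                   (place {σ = σ} p) ≡ (x ⊕ β) v
      lookup-place x {vs} {v = inj₁ q} p =
        trans (lookup-++ˡ (select M x (lefts vs)) _ (position (∈-lefts p))) (lookup-position x (∈-lefts p))
      lookup-place x {vs} {v = inj₂ j} p =
        trans (lookup-++ʳ (select M x (lefts vs)) (select M proj₂ (elems β (rights vs)))
                          (param-position β (∈-rights p)))
              (lookup-param β (∈-rights p))

    plugIn : VFormula (σ ⊕ˢ τ) → FormulaOver M B σ
    plugIn (vs , φ) = record
      { vars = lefts vs ; params = elems β (rights vs)
      ; params∈ = all-elems (rights vs) ; formula = rename (assign place) φ }

    Holds-plugIn : (φ : VFormula (σ ⊕ˢ τ)) (x : Tuple M σ) →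
                   (x ⊕ β) ⊨ φ ⇔ Holds M (plugIn φ) x
    Holds-plugIn (vs , φ) x = Sat-rename (agree-assign place (x ⊕ β) _ (lookup-place x)) φ

    sameType⇒≼ : {x y : Tuple M σ} → SameType M B x y → x ⊕ β ≼ y ⊕ β
    sameType⇒≼ {x = x} {y = y} h φ xφ =
      from (Holds-plugIn φ y) (to (h (plugIn φ)) (to (Holds-plugIn φ x) xφ))

-- Automorphisms and their action on types and algebraic closures.

module Automorphisms {ℓ : Level} {L : Signature ℓ} (M : Structure L) where
  open Signature L
  open Structure M
  open Renaming M public
  open Automorphism using (perm; to-fun; to-rel; apply) renaming (to to act) public

  back : (α : Automorphism M) → ∀ {s} → Carrier s → Carrier s
  back α {s} = Inverse.from (perm α s)

  act-back : (α : Automorphism M) → ∀ {s} (y : Carrier s) → act α (back α y) ≡ y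
  act-back α {s} y = Inverse.inverseˡ (perm α s) refl

  back-act : (α : Automorphism M) → ∀ {s} (x : Carrier s) → back α (act α x) ≡ x
  back-act α {s} x = Inverse.inverseʳ (perm α s) refl

  map-act-back : (α : Automorphism M) → ∀ {ss} (xs : All Carrier ss) →
                 All.map (act α) (All.map (back α) xs) ≡ xs
  map-act-back α []       = refl
  map-act-back α (x ∷ xs) = cong₂ _∷_ (act-back α x) (map-act-back α xs)

  inverse : Automorphism M → Automorphism M
  inverse α = record
    { perm = λ s → ↔-sym (perm α s)
    ; to-fun = λ f xs → trans
        (cong (back α ∘ ⟦ f ⟧ᶠ) (sym (map-act-back α xs)))
        (trans (cong (back α) (sym (to-fun α f (All.map (back α) xs)))) (back-act α _))
    ; to-rel = λ R xs → mk⇔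
        (λ h → from (to-rel α R _) (subst ⟦ R ⟧ʳ (sym (map-act-back α xs)) h))
        (λ h → subst ⟦ R ⟧ʳ (map-act-back α xs) (to (to-rel α R _) h)) }

  map-∘ᴬ : ∀ {P Q R : Sort → Set (lsuc ℓ)} {f : ∀ {s} → Q s → R s} {g : ∀ {s} → P s → Q s}
           {ss} (xs : All P ss) → All.map f (All.map g xs) ≡ All.map (λ {s} x → f {s} (g x)) xs
  map-∘ᴬ []       = refl
  map-∘ᴬ (x ∷ xs) = cong (_ ∷_) (map-∘ᴬ xs)

  compose : Automorphism M → Automorphism M → Automorphism M
  compose β α = record
    { perm = λ s → perm β s ↔-∘ perm α s
    ; to-fun = λ f xs → trans (cong (act β) (to-fun α f xs))
        (trans (to-fun β f _) (cong ⟦ f ⟧ᶠ (map-∘ᴬ xs)))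
    ; to-rel = λ R xs → mk⇔
        (λ h → subst ⟦ R ⟧ʳ (map-∘ᴬ xs) (to (to-rel β R _) (to (to-rel α R _) h)))
        (λ h → from (to-rel α R _) (from (to-rel β R _) (subst ⟦ R ⟧ʳ (sym (map-∘ᴬ xs)) h))) }

  identity : Automorphism M
  identity = record
    { perm = λ s → ↔-id _
    ; to-fun = λ f xs → cong ⟦ f ⟧ᶠ (sym (map-idᴬ xs))
    ; to-rel = λ R xs → mk⇔ (subst ⟦ R ⟧ʳ (sym (map-idᴬ xs))) (subst ⟦ R ⟧ʳ (map-idᴬ xs)) }
    where
    map-idᴬ : ∀ {ss} (xs : All Carrier ss) → All.map id xs ≡ xs
    map-idᴬ []       = refl
    map-idᴬ (x ∷ xs) = cong (x ∷_) (map-idᴬ xs)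

  module _ (α : Automorphism M) where

    lookup-act : ∀ {Γ s} (ρ : All Carrier Γ) (x : s ∈ˡ Γ) →
                 All.lookup (All.map (act α) ρ) x ≡ act α (All.lookup ρ x)
    lookup-act (c ∷ ρ) (here refl) = refl
    lookup-act (c ∷ ρ) (there x)   = lookup-act ρ x

    act-⟦⟧  : ∀ {Γ s} (t : Term L Γ s) (ρ : All Carrier Γ) →
              ⟦_⟧ M t (All.map (act α) ρ) ≡ act α (⟦_⟧ M t ρ)
    act-⟦⟧* : ∀ {Γ ss} (ts : All (Term L Γ) ss) (ρ : All Carrier Γ) →
              ⟦_⟧* M ts (All.map (act α) ρ) ≡ All.map (act α) (⟦_⟧* M ts ρ)
    act-⟦⟧ (var x) ρ    = lookup-act ρ x
    act-⟦⟧ (fun f ts) ρ = trans (cong ⟦ f ⟧ᶠ (act-⟦⟧* ts ρ)) (sym (to-fun α f _))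
    act-⟦⟧* [] ρ        = refl
    act-⟦⟧* (t ∷ ts) ρ  = cong₂ _∷_ (act-⟦⟧ t ρ) (act-⟦⟧* ts ρ)

    act-injective : ∀ {s} {x y : Carrier s} → act α x ≡ act α y → x ≡ y
    act-injective {x = x} {y} e = trans (sym (back-act α x)) (trans (cong (back α) e) (back-act α y))

    Sat-act : ∀ {Γ} (φ : Formula L Γ) (ρ : All Carrier Γ) →
              Sat M φ ρ ⇔ Sat M φ (All.map (act α) ρ)
    Sat-act (rel R ts) ρ =
      mk⇔ (λ h → subst ⟦ R ⟧ʳ (sym (act-⟦⟧* ts ρ)) (to (to-rel α R _) h))
          (λ h → from (to-rel α R _) (subst ⟦ R ⟧ʳ (act-⟦⟧* ts ρ) h))
    Sat-act (eq t u) ρ =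
      mk⇔ (λ e → trans (act-⟦⟧ t ρ) (trans (cong (act α) e) (sym (act-⟦⟧ u ρ))))
          (λ e → act-injective (trans (sym (act-⟦⟧ t ρ)) (trans e (act-⟦⟧ u ρ))))
    Sat-act fls ρ = mk⇔ (λ ()) (λ ())
    Sat-act (φ ⇒ ψ) ρ =
      mk⇔ (λ k → to (Sat-act ψ ρ) ∘ k ∘ from (Sat-act φ ρ))
          (λ k → from (Sat-act ψ ρ) ∘ k ∘ to (Sat-act φ ρ))
    Sat-act (all′ s φ) ρ =
      mk⇔ (λ k c → subst (λ c → Sat M φ (c ∷ All.map (act α) ρ)) (act-back α c)
                         (to (Sat-act φ (back α c ∷ ρ)) (k (back α c))))
          (λ k c → from (Sat-act φ (c ∷ ρ)) (k (act α c)))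

    ⊨-act : ∀ {i} {Q : Set i} {σ : Q → Sort} {x y : Tuple M σ} →
            (∀ q → act α (x q) ≡ y q) → x ≼ y
    ⊨-act {x = x} {y} h (vs , φ) xφ = subst (Sat M φ) (map-select vs) (to (Sat-act φ _) xφ)
      where
      map-select : ∀ vs → All.map (act α) (select M x vs) ≡ select M y vs
      map-select []       = refl
      map-select (v ∷ vs) = cong₂ _∷_ (h v) (map-select vs)

    Fixes : Subset M → Set (lsuc ℓ)
    Fixes B = ∀ b → b ∈ᴾ B → apply α b ≡ b

    fixes⇒sameType : ∀ {B} → Fixes B → ∀ {i} {Q : Set i} {σ : Q → Sort} {x y : Tuple M σ} →
                     (∀ q → act α (x q) ≡ y q) → SameType M B x y
    fixes⇒sameType {B} fix {σ = σ} {x} {y} h φ =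
      mk⇔ (λ s → subst (Sat M formula) (moved vars params∈) (to (Sat-act formula _) s))
          (λ s → from (Sat-act formula _) (subst (Sat M formula) (sym (moved vars params∈)) s))
      where
      open FormulaOver φ
      moved : ∀ vs {ps} → All (_∈ᴾ B) ps →
              All.map (act α) (++⁺ (select M x vs) (select M proj₂ ps)) ≡
              ++⁺ (select M y vs) (select M proj₂ ps)
      moved (v ∷ vs) ps∈        = cong₂ _∷_ (h v) (moved vs ps∈)
      moved [] []               = refl
      moved [] (p∈ ∷ ps∈)       = cong₂ _∷_ (,-injectiveʳ (fix _ p∈)) (moved [] ps∈)

    apply-back : ∀ y → apply α (apply (inverse α) y) ≡ y
    apply-back (s , y) = cong (s ,_) (act-back α y)

    back-apply : ∀ x → apply (inverse α) (apply α x) ≡ x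
    back-apply (s , x) = cong (s ,_) (back-act α x)

    fixes-inverse : ∀ {B} → Fixes B → ∀ b → b ∈ᴾ B → apply (inverse α) b ≡ b
    fixes-inverse fix b b∈ = trans (cong (apply (inverse α)) (sym (fix _ b∈))) (back-apply b)

    mapsOnto : ∀ {A A′} → (∀ {x} → x ∈ᴾ A → apply α x ∈ᴾ A′) →
               (∀ {y} → y ∈ᴾ A′ → apply (inverse α) y ∈ᴾ A) → MapsOnto M α A A′
    mapsOnto f g = f , λ {y} y∈ → apply (inverse α) y , g y∈ , apply-back y

    mapsOnto-back : ∀ {A A′} → MapsOnto M α A A′ → ∀ {y} → y ∈ᴾ A′ → apply (inverse α) y ∈ᴾ A
    mapsOnto-back {A} (_ , onto) y∈ with onto y∈
    ... | x , x∈ , refl = subst A (sym (back-apply x)) x∈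

    mapsOnto-inverse : ∀ {A A′} → MapsOnto M α A A′ → MapsOnto M (inverse α) A′ A
    mapsOnto-inverse m = mapsOnto-back m , λ {x} x∈ → apply α x , proj₁ m x∈ , back-apply x

    fixes⇒mapsOnto : ∀ {B} → Fixes B → MapsOnto M α B B
    fixes⇒mapsOnto {B} fix =
      mapsOnto (λ b∈ → subst B (sym (fix _ b∈)) b∈) (λ b∈ → subst B (sym (fixes-inverse fix _ b∈)) b∈)

    mapsOnto-∪ : ∀ {A A′ B B′} → MapsOnto M α A A′ → MapsOnto M α B B′ →
                 MapsOnto M α (A ∪ B) (A′ ∪ B′)
    mapsOnto-∪ m n = mapsOnto (Sum.map (proj₁ m) (proj₁ n))
                              (Sum.map (mapsOnto-back m) (mapsOnto-back n))

    mapsOnto-range : ∀ {I : Set ℓ} {σ : I → Sort} {x y : Tuple M σ} →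
                     (∀ i → act α (x i) ≡ y i) → MapsOnto M α (range M x) (range M y)
    mapsOnto-range h = mapsOnto
      (λ { (i , refl) → i , cong (_ ,_) (sym (h i)) })
      (λ { (i , refl) → i , cong (_ ,_) (trans (sym (back-act α _)) (cong (back α) (h i))) })

  module _ (α : Automorphism M) where
    private
      shift : ∀ {i} {Q : Set i} {σ : Q → Sort} (vs : List Q) ps →
              Ren (map σ vs ++ map proj₁ ps) (map σ vs ++ map proj₁ (map (apply α) ps))
      shift [] (p ∷ ps) (here e)   = here e
      shift {σ = σ} [] (p ∷ ps) (there x)  = there (shift {σ = σ} [] ps x)
      shift (v ∷ vs) ps (here e)   = here e
      shift {σ = σ} (v ∷ vs) ps (there x)  = there (shift {σ = σ} vs ps x)

      lookup-shift : ∀ {i} {Q : Set i} {σ : Q → Sort} {x y : Tuple M σ} →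
        (∀ q → act α (x q) ≡ y q) → ∀ (vs : List Q) ps {s} (z : s ∈ˡ map σ vs ++ map proj₁ ps) →
        All.lookup (++⁺ (select M y vs) (select M proj₂ (map (apply α) ps))) (shift {σ = σ} vs ps z) ≡
        All.lookup (All.map (act α) (++⁺ (select M x vs) (select M proj₂ ps))) z
      lookup-shift h [] (p ∷ ps) (here refl)       = refl
      lookup-shift h [] (p ∷ ps) (there z)         = lookup-shift h [] ps z
      lookup-shift h (v ∷ vs) ps (here refl)       = sym (h v)
      lookup-shift h (v ∷ vs) ps (there z)         = lookup-shift h vs ps z

    module _ {B B′ : Subset M} (h : ∀ {b} → b ∈ᴾ B → apply α b ∈ᴾ B′) where

      moveParams : ∀ {i} {Q : Set i} {σ : Q → Sort} → FormulaOver M B σ → FormulaOver M B′ σ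
      moveParams {σ = σ} φ = record
        { vars = vars ; params = map (apply α) params ; params∈ = moved params∈
        ; formula = rename (shift {σ = σ} vars params) formula }
        where
        open FormulaOver φ
        moved : ∀ {ps} → All (_∈ᴾ B) ps → All (_∈ᴾ B′) (map (apply α) ps)
        moved []         = []
        moved (p∈ ∷ ps∈) = h p∈ ∷ moved ps∈

      Holds-moveParams : ∀ {i} {Q : Set i} {σ : Q → Sort} (φ : FormulaOver M B σ) {x y : Tuple M σ} →
                         (∀ q → act α (x q) ≡ y q) → Holds M φ x ⇔ Holds M (moveParams φ) y
      Holds-moveParams φ {x} {y} e = mk⇔
        (λ s → to (Sat-rename ag formula) (to (Sat-act α formula _) s))
        (λ s → from (Sat-act α formula _) (from (Sat-rename ag formula) s))
        where
        open FormulaOver φ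
        ag = agree (lookup-shift e vars params)

      acl-act : ∀ {d} → d ∈ᴾ acl M B → apply α d ∈ᴾ acl M B′
      acl-act {s , d} (φ , hφ , xs , all) =
        moveParams φ , to (Holds-moveParams φ λ _ → refl) hφ , map (act α) xs ,
        λ y hy → subst (_∈ˡ map (act α) xs) (act-back α y)
          (∈-map⁺ (act α) (all (back α y) (from (Holds-moveParams φ λ _ → act-back α y) hy)))

  acl-fixes : ∀ α {B} → Fixes α B → MapsOnto M α (acl M B) (acl M B)
  acl-fixes α {B} fix =
    mapsOnto α (acl-act α (proj₁ (fixes⇒mapsOnto α fix)))
               (acl-act (inverse α) (mapsOnto-back α (fixes⇒mapsOnto α fix)))

  weaken : ∀ {B B′ : Subset M} → B ⊆ B′ → ∀ {i} {Q : Set i} {σ : Q → Sort} →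
           FormulaOver M B σ → FormulaOver M B′ σ
  weaken h φ = record { vars = vars ; params = params ; params∈ = All.map h params∈ ; formula = formula }
    where open FormulaOver φ

  sameType-⊆ : ∀ {B B′ : Subset M} → B ⊆ B′ → ∀ {i} {Q : Set i} {σ : Q → Sort} {x y : Tuple M σ} →
               SameType M B′ x y → SameType M B x y
  sameType-⊆ h t φ = t (weaken h φ)

  acl-mono : ∀ {B B′ : Subset M} → B ⊆ B′ → acl M B ⊆ acl M B′
  acl-mono h (φ , hφ , fin) = weaken h φ , hφ , fin

  ⊆-acl : ∀ {B : Subset M} → B ⊆ acl M B
  ⊆-acl {x = s , b} b∈ =
    record { vars = tt ∷ [] ; params = (s , b) ∷ [] ; params∈ = b∈ ∷ []
           ; formula = eq (var (here refl)) (var (there (here refl))) } ,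
    refl , b ∷ [] , λ { y refl → here refl }

  acl-finite : ∀ {A d} → d ∈ᴾ acl M A → ∃[ xs ] All (_∈ᴾ A) xs × d ∈ᴾ acl M (_∈ˡ xs)
  acl-finite (φ , hφ , fin) = params , params∈ ,
    record { vars = vars ; params = params ; params∈ = All.tabulate id ; formula = formula } , hφ , fin
    where open FormulaOver φ

-- Consequences of saturation and homogeneity; algebraic closure.

module Big (em : ∀ {a : Level} → ExcludedMiddle a) {ℓ : Level} {L : Signature ℓ}
           {T : Theory L} (𝕄 : BigModel T) where
  open Signature L
  open BigModel 𝕄 using (saturated; stronglyHomogeneous) renaming (structure to M) public
  open Structure M
  open Automorphisms M public

  ¬∀⇒∃¬ : ∀ {a b} {A : Set a} {B : A → Set b} → ¬ (∀ x → B x) → Σ A λ x → ¬ B x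
  ¬∀⇒∃¬ {A = A} {B} h with em {P = Σ A λ x → ¬ B x}
  ... | yes e = e
  ... | no ne = contradiction (λ x → decidable-stable em λ nb → ne (x , nb)) h

  -- Types are maximal: a formula that fails has a true negation, so an inclusion of types is an
  -- equality.
  ≼-sym : ∀ {i} {Q : Set i} {σ : Q → Sort} {x y : Tuple M σ} → x ≼ y → y ≼ x
  ≼-sym {x = x} h φ yφ with em {P = x ⊨ φ}
  ... | yes xφ = xφ
  ... | no ¬xφ with () ← h (negate φ) (λ xφ → contradiction xφ ¬xφ) yφ

  ≼⇒automorphism : ∀ {I : Set ℓ} {σ : I → Sort} {x y : Tuple M σ} → x ≼ y →
                   Σ (Automorphism M) λ α → ∀ i → act α (x i) ≡ y i
  ≼⇒automorphism {σ = σ} {x} {y} h =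
    stronglyHomogeneous x y λ φ → mk⇔ (transfer h φ) (transfer (≼-sym h) φ)
    where
    drop : ∀ {Γ} → Ren (Γ ++ []) Γ
    drop {_ ∷ _} (here e)  = here e
    drop {_ ∷ _} (there z) = there (drop z)

    lookup-drop : ∀ {Γ} (ρ : All Carrier Γ) {s} (z : s ∈ˡ Γ ++ []) →
                  All.lookup ρ (drop z) ≡ All.lookup (++⁺ ρ []) z
    lookup-drop (_ ∷ _) (here refl) = refl
    lookup-drop (_ ∷ ρ) (there z)   = lookup-drop ρ z

    transfer : {x y : Tuple M σ} → x ≼ y → (φ : FormulaOver M (λ _ → ⊥ₚ.⊥) σ) →
               Holds M φ x → Holds M φ y
    transfer h record { params = _ ∷ _ ; params∈ = () ∷ _ } _
    transfer {x} {y} h record { vars = vs ; params = [] ; formula = φ } xφ =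
      from (Sat-rename (agree (lookup-drop (select M y vs))) φ)
        (h (vs , rename drop φ) (to (Sat-rename (agree (lookup-drop (select M x vs))) φ) xφ))

  -- Exactly enumerates B, unlike Small, which allows a larger range.
  record Enumeration (B : Subset M) : Set (lsuc ℓ) where
    field
      {Index} : Set ℓ
      {sort}  : Index → Sort
      tuple   : Tuple M sort
      member  : ∀ j → (sort j , tuple j) ∈ᴾ B
      index   : ∀ {x} → x ∈ᴾ B → ∃[ j ] (sort j , tuple j) ≡ x

  enumerate : ∀ {B} → Small M B → Enumeration B
  enumerate {B} (I , f , cover) = record
    { Index = Σ I λ i → True (em {P = f i ∈ᴾ B})
    ; tuple = λ (i , _) → proj₂ (f i)
    ; member = λ (_ , t) → toWitness t
    ; index = λ {x} x∈ → let i , e = cover x∈ in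
        (i , fromWitness (subst B (sym e) x∈)) , e }

  module _ {B : Subset M} (E : Enumeration B) where
    open Enumeration E renaming (tuple to β)

    fixes-enumeration : ∀ α → (∀ j → act α (β j) ≡ β j) → Fixes α B
    fixes-enumeration α h _ b∈ with index b∈
    ... | j , refl = cong (_ ,_) (h j)

    ≼⇒fixes : ∀ {I : Set ℓ} {σ : I → Sort} {x y : Tuple M σ} → x ⊕ β ≼ y ⊕ β →
              Σ (Automorphism M) λ α → Fixes α B × (∀ i → act α (x i) ≡ y i)
    ≼⇒fixes h with ≼⇒automorphism h
    ... | α , e = α , fixes-enumeration α (e ∘ inj₂) , e ∘ inj₁

    fixes⇒≼ : ∀ α → Fixes α B → ∀ {i} {I : Set i} {σ : I → Sort} {x y : Tuple M σ} →
              (∀ i → act α (x i) ≡ y i) → x ⊕ β ≼ y ⊕ β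
    fixes⇒≼ α fix e = ⊨-act α λ { (inj₁ q) → e q ; (inj₂ j) → ,-injectiveʳ (fix _ (member j)) }

    sameType⇒fixes : ∀ {I : Set ℓ} {σ : I → Sort} {x y : Tuple M σ} → SameType M B x y →
                     Σ (Automorphism M) λ α → Fixes α B × (∀ i → act α (x i) ≡ y i)
    sameType⇒fixes h = ≼⇒fixes (sameType⇒≼ β member h)

  small-⊆ : ∀ {A B : Subset M} → A ⊆ B → Small M B → Small M A
  small-⊆ h (I , f , cover) = I , f , cover ∘ h

  small-∪ : ∀ {A B : Subset M} → Small M A → Small M B → Small M (A ∪ B)
  small-∪ (I , f , c) (J , g , d) = (I ⊎ J) , Sum.[ f , g ] ,
    λ { (inj₁ p) → let i , e = c p in inj₁ i , e ; (inj₂ p) → let j , e = d p in inj₂ j , e }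

  small-range : ∀ {I : Set ℓ} {σ : I → Sort} (a : Tuple M σ) → Small M (range M a)
  small-range {I = I} {σ} a = I , (λ i → σ i , a i) , id

  small-image : ∀ α {A A′} → MapsOnto M α A A′ → Small M A → Small M A′
  small-image α m (I , f , c) = I , apply α ∘ f ,
    λ y∈ → let i , e = c (mapsOnto-back α m y∈) in i , trans (cong (apply α) e) (apply-back α _)

  small-list : ∀ (xs : List (Elem M)) → Small M (_∈ˡ xs)
  small-list [] = ⊥ₚ.⊥ , (λ ()) , λ ()
  small-list (x ∷ xs) = let I , f , c = small-list xs in
    (⊤ₚ.⊤ {ℓ} ⊎ I) , (λ { (inj₁ _) → x ; (inj₂ i) → f i }) ,
    λ { (here e) → inj₁ _ , sym e ; (there p) → let i , e = c p in inj₂ i , e }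

  -- An algebraic element is recovered from a formula, indices of its parameters and a position in a
  -- list of solutions chosen once for that formula. Such codes form a type in `Set ℓ`, although the
  -- lists in the definition of `acl` do not.
  small-acl : ∀ {B} → Small M B → Small M (acl M B)
  small-acl {B} (I , f , cover) = Code , decode , encode
    where
    Shape : Sort → List ⊤ → List I → Set ℓ
    Shape s vs is = Formula L (map (λ _ → s) vs ++ map proj₁ (map f is))

    Code : Set ℓ
    Code = Σ Sort λ s → Σ (List ⊤) λ vs → Σ (List I) λ is → Shape s vs is × ℕ

    Solves : ∀ s vs is → Shape s vs is → Carrier s → Set (lsuc ℓ)
    Solves s vs is φ y = Sat M φ (++⁺ (select M (λ _ → y) vs) (select M proj₂ (map f is)))

    Solutions : ∀ s vs is → Shape s vs is → Set (lsuc ℓ)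
    Solutions s vs is φ = Σ (List (Carrier s)) λ xs → ∀ y → Solves s vs is φ y → y ∈ˡ xs

    nth : ∀ {s} → List (Carrier s) → ℕ → Carrier s
    nth []       n       = inhabited _
    nth (x ∷ xs) zero    = x
    nth (x ∷ xs) (suc n) = nth xs n

    nth-∈ : ∀ {s} {x : Carrier s} {xs} → x ∈ˡ xs → ∃[ n ] nth xs n ≡ x
    nth-∈ (here refl) = 0 , refl
    nth-∈ (there p)   = let n , e = nth-∈ p in suc n , e

    candidates : ∀ s vs is φ → Dec (Solutions s vs is φ) → List (Carrier s)
    candidates s vs is φ (yes (xs , _)) = xs
    candidates s vs is φ (no _)         = []

    decode : Code → Elem M
    decode (s , vs , is , φ , n) = s , nth (candidates s vs is φ em) n

    indices : ∀ {ps} → All (_∈ᴾ B) ps → Σ (List I) λ is → map f is ≡ ps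
    indices []         = [] , refl
    indices (p∈ ∷ ps∈) = let i , e = cover p∈ ; is , es = indices ps∈ in
      i ∷ is , cong₂ _∷_ e es

    encode : ∀ {x} → x ∈ᴾ acl M B → ∃[ c ] decode c ≡ x
    encode {s , x} (record { vars = vs ; params∈ = ps∈ ; formula = φ } , xφ , fin)
      with indices ps∈
    ... | is , refl with em {P = Solutions s vs is φ} in eq
    ...   | no ¬fin = contradiction fin ¬fin
    ...   | yes (xs , all) = let n , e = nth-∈ (all x xφ) in
      (s , vs , is , φ , n) ,
      cong (s ,_) (trans (cong (λ d → nth (candidates s vs is φ d) n) eq) e)

  module _ {i} {Q : Set i} {σ : Q → Sort} where

    both : VFormula σ → VFormula σ → VFormula σ
    both (vs , φ) (ws , ψ) = vs ++ ws ,
      ((rename (assign (position ∘ ∈-++⁺ˡ)) φ ⇒ (rename (assign (position ∘ ∈-++⁺ʳ vs)) ψ ⇒ fls)) ⇒ fls)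

    ⊨-both : ∀ φ ψ {x : Tuple M σ} → x ⊨ both φ ψ ⇔ (x ⊨ φ × x ⊨ ψ)
    ⊨-both (vs , φ) (ws , ψ) {x} = mk⇔
      (λ h → decidable-stable em (λ n → elim (h λ p _ → contradiction (from renφ p) n)) ,
             decidable-stable em (λ n → elim (h λ _ q → contradiction (from renψ q) n)))
      (λ (p , q) k → k (to renφ p) (to renψ q))
      where
      elim : ∀ {a} {A : Set a} → ⊥ₚ.⊥ {lsuc ℓ} → A
      elim ()
      renφ = Sat-rename (agree-assign (position ∘ ∈-++⁺ˡ) x (select M x (vs ++ ws))
               λ p → lookup-position x (∈-++⁺ˡ p)) φ
      renψ = Sat-rename (agree-assign (position ∘ ∈-++⁺ʳ vs) x (select M x (vs ++ ws))
               λ p → lookup-position x (∈-++⁺ʳ vs p)) ψ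

    conjunction : List (VFormula σ) → VFormula σ
    conjunction []       = [] , (fls ⇒ fls)
    conjunction (φ ∷ φs) = both φ (conjunction φs)

    ⊨-conjunction : ∀ φs {x : Tuple M σ} → x ⊨ conjunction φs ⇔ All (x ⊨_) φs
    ⊨-conjunction []       = mk⇔ (λ _ → []) (λ _ → id)
    ⊨-conjunction (φ ∷ φs) = mk⇔
      (λ h → let p , q = to (⊨-both φ (conjunction φs)) h in p ∷ to (⊨-conjunction φs) q)
      (λ { (p ∷ q) → from (⊨-both φ (conjunction φs)) (p , from (⊨-conjunction φs) q) })

  module _ {B : Subset M} (smallB : Small M B) where
    private
      module E = Enumeration (enumerate smallB)
      β = E.tuple

    -- Saturation: the formulas of tp(x/B) and y ≠ c for c ∈ xs have no common solution,
    -- so finitely many formulas of tp(x/B) already confine y to xs.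
    finiteOrbit⇒acl : ∀ {s} {x : Carrier s} {xs : List (Carrier s)} →
                      (∀ α → Fixes α B → act α x ∈ˡ xs) → (s , x) ∈ᴾ acl M B
    finiteOrbit⇒acl {s} {x} {xs} orbit = decidable-stable em λ x∉ →
      let c , hc = saturated small p (finitelySatisfiable x∉)
          α , fix , αx≡c = ≼⇒fixes (enumerate smallB) {x = λ _ → x} {y = c}
            λ φ xφ → from (Holds-plugIn β {B⁺} member⁺ φ c) (hc (inj₁ (φ , xφ , refl)))
      in lower (hc (inj₂ (c _ , subst (_∈ˡ xs) (αx≡c _) (orbit α fix) , refl)) refl)
      where
      B⁺ : Subset M
      B⁺ = B ∪ (_∈ˡ map (s ,_) xs)

      member⁺ : ∀ j → (E.sort j , β j) ∈ᴾ B⁺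
      member⁺ j = inj₁ (E.member j)

      small : Small M B⁺
      small = small-∪ smallB (small-list _)

      σ : ⊤ₚ.⊤ {ℓ} → Sort
      σ _ = s

      differs : ∀ {c} → c ∈ˡ xs → FormulaOver M B⁺ σ
      differs {c} c∈ = record
        { vars = _ ∷ [] ; params = (s , c) ∷ [] ; params∈ = inj₂ (∈-map⁺ (s ,_) c∈) ∷ []
        ; formula = eq (var (here refl)) (var (there (here refl))) ⇒ fls }

      plug : VFormula (σ ⊕ˢ E.sort) → FormulaOver M B⁺ σ
      plug = plugIn β {B⁺} member⁺

      p : Pred (FormulaOver M B⁺ σ) (lsuc ℓ)
      p φ = (Σ (VFormula (σ ⊕ˢ E.sort)) λ ψ → ((λ _ → x) ⊕ β) ⊨ ψ × φ ≡ plug ψ) ⊎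
            (Σ (Carrier s) λ c → Σ (c ∈ˡ xs) λ c∈ → φ ≡ differs c∈)

      realised : ∀ {φs} → All (_∈ᴾ p) φs → List (VFormula (σ ⊕ˢ E.sort))
      realised []                     = []
      realised (inj₁ (ψ , _) ∷ hs)    = ψ ∷ realised hs
      realised (inj₂ _ ∷ hs)          = realised hs

      realised-true : ∀ {φs} (hs : All (_∈ᴾ p) φs) → All (((λ _ → x) ⊕ β) ⊨_) (realised hs)
      realised-true []                        = []
      realised-true (inj₁ (ψ , xψ , _) ∷ hs)  = xψ ∷ realised-true hs
      realised-true (inj₂ _ ∷ hs)             = realised-true hs

      satisfied : ∀ {y : Carrier s} → ¬ (y ∈ˡ xs) → ∀ {φs} (hs : All (_∈ᴾ p) φs) →
                  All (((λ _ → y) ⊕ β) ⊨_) (realised hs) → All (λ φ → Holds M φ (λ _ → y)) φs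
      satisfied y∉ [] _ = []
      satisfied y∉ (inj₁ (ψ , _ , refl) ∷ hs) (yψ ∷ yψs) =
        to (Holds-plugIn β {B⁺} member⁺ ψ _) yψ ∷ satisfied y∉ hs yψs
      satisfied y∉ (inj₂ (c , c∈ , refl) ∷ hs) yψs =
        (λ { refl → contradiction c∈ y∉ }) ∷ satisfied y∉ hs yψs

      -- `acl` takes its single variable from `⊤`, saturation from a type in `Set ℓ`; reindexing
      -- passes between the two.
      σ₀ : ⊤ → Sort
      σ₀ _ = s

      g : ⊤ₚ.⊤ {ℓ} ⊎ E.Index → ⊤ ⊎ E.Index
      g = Sum.map (λ _ → tt) id

      e : ∀ q → (σ₀ ⊕ˢ E.sort) (g q) ≡ (σ ⊕ˢ E.sort) q
      e (inj₁ _) = refl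
      e (inj₂ _) = refl

      g-correct : ∀ {y : Carrier s} {vs : List (⊤ₚ.⊤ ⊎ E.Index)} {q} → q ∈ˡ vs →
        subst Carrier (e q) (((λ _ → y) ⊕ β) (g q)) ≡ ((λ _ → y) ⊕ β) q
      g-correct {q = inj₁ _} _ = refl
      g-correct {q = inj₂ _} _ = refl

      finitelySatisfiable : ¬ ((s , x) ∈ᴾ acl M B) → ∀ φs → All (_∈ᴾ p) φs →
                            Σ (Tuple M σ) λ c → All (λ φ → Holds M φ c) φs
      finitelySatisfiable x∉ φs hs =
        let y , ¬y = ¬∀⇒∃¬ {B = λ y → Holds M ψ (λ _ → y) → y ∈ˡ xs}
                       λ all → x∉ (ψ , hold (from (⊨-conjunction ψs) (realised-true hs)) , xs , all)
            y∉  = λ y∈ → ¬y λ _ → y∈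
            yψ  = decidable-stable em λ n → ¬y λ yψ → contradiction yψ n
        in (λ _ → y) , satisfied y∉ hs (to (⊨-conjunction ψs) (unhold yψ))
        where
        ψs = realised hs
        ψ₀ = reindex {σ′ = σ₀ ⊕ˢ E.sort} g e (conjunction ψs)
        ψ = plugIn β {B} E.member {σ = σ₀} ψ₀
        reindexed : ∀ y → ((λ _ → y) ⊕ β) ⊨ conjunction ψs ⇔ (_⊕_ {σ = σ₀} (λ _ → y) β) ⊨ ψ₀
        reindexed y = ⊨-reindex g e (conjunction ψs) g-correct
        hold : ∀ {y} → ((λ _ → y) ⊕ β) ⊨ conjunction ψs → Holds M ψ (λ _ → y)
        hold {y} h = to (Holds-plugIn β {B} E.member ψ₀ (λ _ → y)) (to (reindexed y) h)
        unhold : ∀ {y} → Holds M ψ (λ _ → y) → ((λ _ → y) ⊕ β) ⊨ conjunction ψs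
        unhold {y} h = from (reindexed y) (from (Holds-plugIn β {B} E.member ψ₀ (λ _ → y)) h)

    private
      conjugates : ∀ {ps} → All (_∈ᴾ acl M B) ps →
                   Σ (List (List (Elem M))) λ pss → ∀ α → Fixes α B → map (apply α) ps ∈ˡ pss
      conjugates [] = [] ∷ [] , λ _ _ → here refl
      conjugates {(s , c) ∷ ps} ((φ , cφ , xs , all) ∷ ps∈) = let pss , h = conjugates ps∈ in
        cartesianProductWith _∷_ (map (s ,_) xs) pss ,
        λ α fix → ∈-cartesianProductWith⁺ _∷_
          (∈-map⁺ (s ,_) (all _ (to (fixes⇒sameType α fix {x = λ _ → c} (λ _ → refl) φ) cφ)))
          (h α fix)

    -- By the orbit criterion, finitely many conjugates of `x` over `B` suffice. The parameters of
    -- `φ` are algebraic over `B`, so their list has finitely many conjugates, and for each one an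
    -- automorphism `α` is fixed. If `γ` moves the parameters as `α` does, then the composite of `γ`
    -- with the inverse of `α` fixes them, so `γ` sends `x` to the `α`-image of a solution of `φ`.
    acl-idempotent : acl M (acl M B) ⊆ acl M B
    acl-idempotent {s , x} (φ , xφ , xs , all) = finiteOrbit⇒acl {xs = concatMap images pss} orbit
      where
      open FormulaOver φ
      pss = proj₁ (conjugates params∈)

      Sends : List (Elem M) → Set _
      Sends qs = Σ (Automorphism M) λ α → Fixes α B × map (apply α) params ≡ qs

      imagesOf : ∀ {qs} → Dec (Sends qs) → List (Carrier s)
      imagesOf (yes (α , _)) = map (act α) xs
      imagesOf (no _)        = []

      images : List (Elem M) → List (Carrier s)
      images qs = imagesOf (em {P = Sends qs})

      map-≡ : ∀ {f g : Elem M → Elem M} ps → map f ps ≡ map g ps → ∀ {p} → p ∈ˡ ps → f p ≡ g p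
      map-≡ (p ∷ ps) e (here refl) = proj₁ (∷-injective e)
      map-≡ (p ∷ ps) e (there q)   = map-≡ ps (proj₂ (∷-injective e)) q

      inImages : ∀ γ → Fixes γ B → (d : Dec (Sends (map (apply γ) params))) → act γ x ∈ˡ imagesOf d
      inImages γ fix (no n) = contradiction (γ , fix , refl) n
      inImages γ fix (yes (α , _ , e)) =
        subst (_∈ˡ map (act α) xs) (act-back α (act γ x))
          (∈-map⁺ (act α) (all _ (to (fixes⇒sameType δ fixδ {x = λ _ → x} (λ _ → refl) φ₀) xφ)))
        where
        δ = compose (inverse α) γ
        fixδ : Fixes δ (_∈ˡ params)
        fixδ b b∈ = trans (cong (apply (inverse α)) (sym (map-≡ params e b∈))) (back-apply α b)
        φ₀ : FormulaOver M (_∈ˡ params) {I = ⊤} (λ _ → s)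
        φ₀ = record { vars = vars ; params = params ; params∈ = All.tabulate id ; formula = formula }

      orbit : ∀ γ → Fixes γ B → act γ x ∈ˡ concatMap images pss
      orbit γ fix = ∈-concatMap⁺ images
        (Any.map (λ { refl → inImages γ fix em }) (proj₂ (conjugates params∈) γ fix))

-- The Erdős-Rado theorem for well-founded trees.

module Trees where

  -- Well-founded trees serve as index sets instead of ordinals: recursion on them
  -- is structural, whereas transfinite recursion along a well-order with
  -- arbitrary choices would need function extensionality.
  data Tree {ℓ} (S : Set ℓ) (P : S → Set ℓ) : Set ℓ where
    node : ∀ s → (P s → Tree S P) → Tree S P

  private variable
    ℓ : Level

  infix 4 _◁_
  _◁_ : {S : Set ℓ} {P : S → Set ℓ} → Tree S P → Tree S P → Set ℓ
  u ◁ node s h = ∃[ p ] h p ≡ u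

  -- The relation `◁` is not transitive, hence a condition on all pairs. The largest entry comes
  -- first.
  Chain : {S : Set ℓ} {P : S → Set ℓ} → ∀ {n} → Vec (Tree S P) n → Set ℓ
  Chain = AllPairs (λ v u → u ◁ v)

  Monotone : {S S′ : Set ℓ} {P : S → Set ℓ} {P′ : S′ → Set ℓ} → (Tree S P → Tree S′ P′) → Set ℓ
  Monotone e = ∀ {u v} → u ◁ v → e u ◁ e v

  ◁-map : {S S′ : Set ℓ} {P : S → Set ℓ} {P′ : S′ → Set ℓ} {e : Tree S P → Tree S′ P′} →
          Monotone e → ∀ {v n} {us : Vec (Tree S P) n} →
          Allᵛ (_◁ v) us → Allᵛ (_◁ e v) (Vec.map e us)
  ◁-map mono []       = []
  ◁-map mono (h ∷ hs) = mono h ∷ ◁-map mono hs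

  data Shape {ℓ} : Set ℓ where
    leaf branch : Shape

  Arity : Set ℓ → Shape {ℓ} → Set ℓ
  Arity X leaf   = ⊥ₚ.⊥
  Arity X branch = X

  module _ (em : ∀ {a : Level} → ExcludedMiddle a)
           {ℓ k : Level} {K : Set ℓ} (_≈_ : Rel K k) (≈-refl : Reflexive _≈_) where

    private module EndHomogeneous {S : Set ℓ} {P : S → Set ℓ} {n : ℕ} where

      -- Codes are the possible outcomes of the recursion that picks elements with
      -- prescribed colours.  The element top lies above all of them, so it witnesses
      -- that picking according to the colours of top itself never gets stuck.
      data Code : Set ℓ where
        code : ∀ s → (P s → Code) → (Vec (P s) n → K) → Code

      Target : Set ℓ
      Target = Tree Shape (Arity Code)

      module _ (c : Vec Target (suc n) → K) where

        Fits : ∀ {A : Set ℓ} → (A → Target) → (Vec A n → K) → Target → Set (ℓ ⊔ k)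
        Fits h π w = (∀ p → h p ◁ w) × (∀ ps → c (w ∷ Vec.map h ps) ≈ π ps)

        realise : ∀ {A : Set ℓ} {h : A → Target} {π} → Dec (Σ Target (Fits h π)) → Target
        realise (yes (w , _)) = w
        realise (no _)        = node leaf λ ()

        realise-fits : ∀ {A : Set ℓ} {h : A → Target} {π w} (d : Dec (Σ Target (Fits h π))) →
                       Fits h π w → Fits h π (realise d)
        realise-fits (yes (_ , f)) _ = f
        realise-fits (no n) f        = contradiction (_ , f) n

        ⟦_⟧ᶜ : Code → Target
        ⟦ code s h π ⟧ᶜ = realise (em {P = Σ Target (Fits (λ p → ⟦ h p ⟧ᶜ) π)})

        top : Target
        top = node branch ⟦_⟧ᶜ

        encode : Tree S P → Code
        encode (node s h) =
          code s (λ p → encode (h p)) (λ ps → c (top ∷ Vec.map (λ p → ⟦ encode (h p) ⟧ᶜ) ps))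

        embed : Tree S P → Target
        embed v = ⟦ encode v ⟧ᶜ

        embed-fits : ∀ s (h : P s → Tree S P) →
          Fits (embed ∘ h) (λ ps → c (top ∷ Vec.map (embed ∘ h) ps)) (embed (node s h))
        embed-fits s h = realise-fits {w = top} em ((λ p → encode (h p) , refl) , λ _ → ≈-refl)

        embed-monotone : Monotone embed
        embed-monotone {v = node s h} (p , refl) = proj₁ (embed-fits s h) p

        preimages : ∀ {A : Set ℓ} {B : Set ℓ} {h : A → B} {m} {us : Vec B m} →
                    Allᵛ (λ u → ∃[ p ] h p ≡ u) us → ∃[ ps ] Vec.map h ps ≡ us
        preimages []               = [] , refl
        preimages ((p , e) ∷ hs)   = let ps , es = preimages hs in p ∷ ps , cong₂ _∷_ e es

        -- End-homogeneity: the colour of a tuple does not depend on its largest entry.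
        embed-endHomogeneous : ∀ {v} {us : Vec (Tree S P) n} → Allᵛ (_◁ v) us →
          c (embed v ∷ Vec.map embed us) ≈ c (top ∷ Vec.map embed us)
        embed-endHomogeneous {node s h} hs with preimages hs
        ... | ps , refl = subst (λ ws → c (embed (node s h) ∷ ws) ≈ c (top ∷ ws))
                                (mapᵛ-∘ embed h ps) (proj₂ (embed-fits s h) ps)

    Homogeneous : {S S′ : Set ℓ} {P : S → Set ℓ} {P′ : S′ → Set ℓ} → ∀ {n} →
                  (Vec (Tree S′ P′) n → K) → (Tree S P → Tree S′ P′) → K → Set (ℓ ⊔ k)
    Homogeneous c e q = ∀ us → Chain us → c (Vec.map e us) ≈ q

    -- Induction on `n`: on an end-homogeneous copy the largest entry may be replaced by the fixed
    -- `top`, which leaves a colouring of shorter tuples. The kind of tree is found before the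
    -- colouring is given, as in a partition relation, with `Code` in place of a cardinal bound.
    -- Colours are compared by `≈` because types are functions, for which only pointwise equality is
    -- available.
    erdősRado : Transitive _≈_ → ∀ n (S : Set ℓ) (P : S → Set ℓ) →
      Σ (Set ℓ) λ S′ → Σ (S′ → Set ℓ) λ P′ → (c : Vec (Tree S′ P′) n → K) →
      Σ (Tree S P → Tree S′ P′) λ e → Monotone e × ∃[ q ] Homogeneous c e q
    erdősRado ≈-trans zero S P = S , P , λ c → id , id , c [] , λ { [] _ → ≈-refl }
    erdősRado ≈-trans (suc n) S P =
      let S₁ , P₁ , homogenise = erdősRado ≈-trans n S P
          open EndHomogeneous {S₁} {P₁} {n}
      in Shape , Arity Code , λ c →
         let e , mono , q , hom = homogenise λ us → c (top c ∷ Vec.map (embed c) us)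
         in embed c ∘ e , embed-monotone c ∘ mono , q ,
            λ { (v ∷ us) (v▷us ∷ chain) → subst (λ ws → c (embed c (e v) ∷ ws) ≈ q)
                  (sym (mapᵛ-∘ (embed c) e us))
                  (≈-trans (embed-endHomogeneous c (◁-map mono v▷us)) (hom us chain)) }

  module _ {Q : Set ℓ} {S : Q → Set ℓ} {P : ∀ q → S q → Set ℓ} where

    -- Trees of several kinds are placed in one: the counterpart of a supremum of cardinals.
    include : ∀ {q} → Tree (S q) (P q) → Tree (Σ Q S) (λ (q , s) → P q s)
    include (node s h) = node (_ , s) λ p → include (h p)

    include-monotone : ∀ {q} → Monotone (include {q})
    include-monotone {v = node s h} (p , refl) = p , refl

  chain-map : {S S′ : Set ℓ} {P : S → Set ℓ} {P′ : S′ → Set ℓ} {e : Tree S P → Tree S′ P′} →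
              Monotone e → ∀ {n} {us : Vec (Tree S P) n} → Chain us → Chain (Vec.map e us)
  chain-map mono []       = []
  chain-map mono (h ∷ hs) = ◁-map mono h ∷ chain-map mono hs

  module _ {ℓ : Level} where

    OmegaTree : Set ℓ
    OmegaTree = Tree (Lift ℓ ℕ) (λ (lift n) → Lift ℓ (Fin n))

    private
      above : List OmegaTree → OmegaTree
      above us = node (lift (length us)) λ (lift k) → lookup us k

      history : ℕ → List OmegaTree
      history zero    = []
      history (suc n) = above (history n) ∷ history n

    -- A copy of ω on which `◁` is transitive, since every stage has all earlier ones as children.
    stage : ℕ → OmegaTree
    stage n = above (history n)

    stage-monotone : ∀ {m n} → m < n → stage m ◁ stage n
    stage-monotone m<n = let p = remembers (≤⇒≤′ m<n) in lift (Any.index p) , sym (lookup-index p)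
      where
      remembers : ∀ {m n} → suc m ≤′ n → stage m ∈ˡ history n
      remembers (≤′-reflexive refl) = here refl
      remembers (≤′-step m<n)       = there (remembers m<n)

open Trees

-- Elementary calculus of independence, without symmetry.

module Independence (em : ∀ {a : Level} → ExcludedMiddle a) {ℓ r : Level} {L : Signature ℓ}
         {T : Theory L} (𝕄 : BigModel T)
         (_⫝⟨_⟩_ : Ternary (BigModel.structure 𝕄) r)
         (isInd : IsIndependence (BigModel.structure 𝕄) _⫝⟨_⟩_) where
  open Big em 𝕄
  open Signature L
  open Structure M
  open IsIndependence isInd

  private variable
    A A′ B B′ B̂ C C′ D X Y : Subset M
    I : Set ℓ
    σ : I → Sort

  resp-≐ : Small M A → Small M B → Small M C → A ≐ A′ → B ≐ B′ → C ≐ C′ →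
           A ⫝⟨ C ⟩ B → A′ ⫝⟨ C′ ⟩ B′
  resp-≐ sA sB sC (f , f⁻) (g , g⁻) (h , h⁻) =
    invariance sA sB sC identity (mapsOnto identity f f⁻) (mapsOnto identity g g⁻)
               (mapsOnto identity h h⁻)

  -- The axiom returns only a set; the automorphism that conjugates it to the range of `a` also
  -- provides the tuple.
  tupleExtension : (a : Tuple M σ) → Small M C → Small M B̂ → range M a ⫝⟨ C ⟩ B → B ⊆ B̂ →
    Σ (Automorphism M) λ α → Fixes α (B ∪ C) × range M (λ i → act α (a i)) ⫝⟨ C ⟩ B̂
  tupleExtension a sC sB̂ a⫝B B⊆B̂ =
    let A′ , (α , fix , m) , A′⫝B̂ = extension (small-range a) sC sB̂ a⫝B B⊆B̂
    in inverse α , fixes-inverse α (λ _ → fix) ,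
       monotonicity (small-image (inverse α) (mapsOnto-inverse α m) (small-range a)) sB̂ sC A′⫝B̂
         (λ { (i , refl) → mapsOnto-back α m (i , refl) }) id

  -- Extension moves `A` by an automorphism over `B ∪ C`. Moving back preserves `acl M (B ∪ C)` as a
  -- set.
  acl-right : Small M A → Small M B → Small M C → A ⫝⟨ C ⟩ B → A ⫝⟨ C ⟩ acl M (B ∪ C)
  acl-right sA sB sC A⫝B =
    let sBC = small-acl (small-∪ sB sC)
        A′ , (α , fix , m) , A′⫝ = extension sA sC sBC A⫝B (⊆-acl ∘ inj₁)
    in invariance (small-image (inverse α) (mapsOnto-inverse α m) sA) sBC sC α m
         (acl-fixes α (λ _ → fix)) (fixes⇒mapsOnto α λ _ c∈ → fix (inj₂ c∈)) A′⫝

  addBase-right : Small M A → Small M B → Small M C → A ⫝⟨ C ⟩ B → A ⫝⟨ C ⟩ (B ∪ C)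
  addBase-right sA sB sC A⫝B =
    monotonicity sA (small-acl (small-∪ sB sC)) sC (acl-right sA sB sC A⫝B) id ⊆-acl

  -- Base monotonicity wants the base inside the right side, so `C` is added there first and dropped
  -- at the end.
  enlargeBase : Small M A → Small M B → Small M C → C ⊆ C′ → C′ ⊆ B ∪ C →
                A ⫝⟨ C ⟩ B → A ⫝⟨ C′ ⟩ B
  enlargeBase sA sB sC C⊆C′ C′⊆ A⫝B =
    monotonicity sA (small-∪ sB sC) (small-⊆ C′⊆ (small-∪ sB sC))
      (baseMonotonicity sA (small-∪ sB sC) C⊆C′ C′⊆ (addBase-right sA sB sC A⫝B)) id inj₁

  -- The axiom for `C ⊆ C ∪ X ⊆ Y ∪ (C ∪ X)`, once normality has put the bases on the left.
  leftTransitivity : Small M A → Small M C → Small M X → Small M Y →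
    X ⫝⟨ C ⟩ A → Y ⫝⟨ C ∪ X ⟩ A → (X ∪ Y) ⫝⟨ C ⟩ A
  leftTransitivity {A} {C} {X} {Y} sA sC sX sY X⫝A Y⫝A =
    monotonicity sYCX sA sC
      (transitivity sA sYCX inj₁ inj₂ (normality sY sA sCX Y⫝A)
        (resp-≐ (small-∪ sX sC) sA sC (Sum.swap , Sum.swap) (id , id) (id , id)
          (normality sX sA sC X⫝A)))
      (λ { (inj₁ x) → inj₂ (inj₂ x) ; (inj₂ y) → inj₁ y }) id
    where
    sCX = small-∪ sC sX
    sYCX = small-∪ sY sCX

  existence : Small M A → Small M C → A ⫝⟨ C ⟩ C
  existence sA sC =
    let _ , choose = localCharacter sA
        _ , D⊆C , _ , A⫝C = choose sC
    in baseMonotonicity sA sC D⊆C id A⫝C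

  Earlier : (ℕ → Tuple M σ) → ℕ → Subset M
  Earlier b n x = ∃[ i ] i < n × x ∈ᴾ range M (b i)

  small-Earlier : {I : Set ℓ} {σ : I → Sort} (b : ℕ → Tuple M σ) → ∀ n → Small M (Earlier b n)
  small-Earlier {I = I} {σ} b n = (ℕ × I) , (λ (k , i) → σ i , b k i) ,
    λ { (k , _ , i , e) → (k , i) , e }

  -- Extraction of a free indiscernible sequence.

  module Extraction {I : Set ℓ} {σ : I → Sort} (a : Tuple M σ) {C D : Subset M} (C⊆D : C ⊆ D)
                    (sD : Small M D) (a⫝D : range M a ⫝⟨ C ⟩ D) where
    private
      sC = small-⊆ C⊆D sD
      E = enumerate sD
      module E = Enumeration E
      β = E.tuple

      _≈_ : Tuple M σ → Tuple M σ → Set (lsuc ℓ)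
      x ≈ y = Σ (Automorphism M) λ α → Fixes α D × (∀ i → act α (x i) ≡ y i)

      Below : {S : Set ℓ} {P : S → Set ℓ} → (Tree S P → Tuple M σ) → Tree S P → Subset M
      Below b w x = ∃[ u ] u ◁ w × x ∈ᴾ range M (b u)

      small-Below : {S : Set ℓ} {P : S → Set ℓ} (b : Tree S P → Tuple M σ) → ∀ w → Small M (Below b w)
      small-Below {S} {P} b w = (Tree S P × I) , (λ (u , i) → σ i , b u i) ,
        λ { (u , _ , i , e) → (u , i) , e }

      Free : {S : Set ℓ} {P : S → Set ℓ} → (Tree S P → Tuple M σ) → Set _
      Free b = ∀ w → a ≈ b w × range M (b w) ⫝⟨ C ⟩ (D ∪ Below b w)

      extend : ∀ {X : Set ℓ} (h : X → Tuple M σ) (sX : Small M (λ x → ∃[ p ] x ∈ᴾ range M (h p))) →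
        Σ (Automorphism M) λ α → Fixes α (D ∪ C) ×
          range M (λ i → act α (a i)) ⫝⟨ C ⟩ (D ∪ (λ x → ∃[ p ] x ∈ᴾ range M (h p)))
      extend h sX = tupleExtension a sC (small-∪ sD sX) a⫝D inj₁

      small-family : ∀ {X : Set ℓ} (h : X → Tuple M σ) → Small M (λ x → ∃[ p ] x ∈ᴾ range M (h p))
      small-family {X} h = (X × I) , (λ (p , i) → σ i , h p i) , λ { (p , i , e) → (p , i) , e }

      free : {S : Set ℓ} {P : S → Set ℓ} → Tree S P → Tuple M σ
      free (node s h) i = act (proj₁ (extend (λ p → free (h p)) (small-family λ p → free (h p)))) (a i)

      free-free : {S : Set ℓ} {P : S → Set ℓ} → Free (free {S} {P})
      free-free (node s h) =
        let α , fix , ⫝ = extend (λ p → free (h p)) (small-family λ p → free (h p))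
        in (α , (λ d d∈ → fix d (inj₁ d∈)) , λ _ → refl) ,
           monotonicity (small-range _) (small-∪ sD (small-family λ p → free (h p))) sC ⫝ id
             (Sum.map id λ { (_ , (p , refl) , x∈) → p , x∈ })

      free-∘ : {S S′ : Set ℓ} {P : S → Set ℓ} {P′ : S′ → Set ℓ} {b : Tree S′ P′ → Tuple M σ} {e : Tree S P → Tree S′ P′} →
               Monotone e → Free b → Free (b ∘ e)
      free-∘ {b = b} {e} mono f w = let a≈ , ⫝ = f (e w) in a≈ ,
        monotonicity (small-range _) (small-∪ sD (small-Below b (e w))) sC ⫝ id
          (Sum.map id λ (u , u◁w , x∈) → e u , mono u◁w , x∈)

      σ^ : ∀ n → Fin n × I → Sort
      σ^ n (_ , i) = σ i

      -- Truth values in `Bool` keep the colours in `Set ℓ`, where `erdősRado` wants them.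
      Type : ℕ → Set ℓ
      Type n = VFormula (σ^ n ⊕ˢ E.sort) → Bool

      _≈ᵗ_ : ∀ {n} → Type n → Type n → Set ℓ
      p ≈ᵗ q = ∀ φ → p φ ≡ q φ

      entries : ∀ {n} → Vec (Tuple M σ) n → Tuple M (σ^ n)
      entries ts (k , i) = Vec.lookup ts k i

      type : ∀ {n} → Vec (Tuple M σ) n → Type n
      type ts φ = does (em {P = entries ts ⊕ β ⊨ φ})

      type⇒≼ : ∀ {n} (ts us : Vec (Tuple M σ) n) → type ts ≈ᵗ type us →
               entries ts ⊕ β ≼ entries us ⊕ β
      type⇒≼ ts us h φ tφ with em {P = entries ts ⊕ β ⊨ φ} | em {P = entries us ⊕ β ⊨ φ} | h φ
      ... | yes _ | yes u | _ = u
      ... | no n  | _     | _ = contradiction tφ n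

      Colours : Set ℓ
      Colours = ∀ n → Type n

      Realised : ℕ → Colours → (S : Set ℓ) (P : S → Set ℓ) → Set (lsuc ℓ ⊔ r)
      Realised n ps S P = Σ (Tree S P → Tuple M σ) λ b → Free b ×
        (∀ k → k < n → (us : Vec (Tree S P) k) → Chain us → type (Vec.map b us) ≈ᵗ ps k)

      -- "Arbitrarily long" is expressed by families over every kind of tree.
      Large : ℕ → Colours → Set _
      Large n ps = ∀ S P → Realised n ps S P

      set : Colours → ∀ n → Type n → Colours
      set ps n q k with k ≟ n
      ... | yes refl = q
      ... | no _     = ps k

      set-here : ∀ ps n q → set ps n q n ≡ q
      set-here ps n q with n ≟ n
      ... | yes refl = refl
      ... | no n≢n   = contradiction refl n≢n

      set-there : ∀ ps n q {k} → k < n → set ps n q k ≡ ps k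
      set-there ps n q {k} k<n with k ≟ n
      ... | yes refl = contradiction k<n (<-irrefl refl)
      ... | no _     = refl

      -- The colour is known only after a family has been coloured. The trees wanted for all colours
      -- are therefore combined, and the part that belongs to the colour found is kept.
      pigeonhole : ∀ n ps → Large n ps → (S : Type n → Set ℓ) (P : ∀ q → S q → Set ℓ) →
                   Σ (Type n) λ q → Realised (suc n) (set ps n q) (S q) (P q)
      pigeonhole n ps large S P
        with S′ , P′ , homogenise ← erdősRado em (_≈ᵗ_ {n}) (λ _ → refl) (λ h k φ → trans (h φ) (k φ)) n
                                      (Σ (Type n) S) (λ (q , s) → P q s)
        with b , freeB , hom ← large S′ P′
        with e , mono , q , homₙ ← homogenise (λ us → type (Vec.map b us))
        = q , b ∘ f , free-∘ {b = b} mono-f freeB , homogeneous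
        where
        f : Tree (S q) (P q) → Tree S′ P′
        f = e ∘ include

        mono-f : Monotone f
        mono-f = mono ∘ include-monotone

        homogeneous : ∀ k → k < suc n → (us : Vec _ k) → Chain us →
                      type (Vec.map (b ∘ f) us) ≈ᵗ set ps n q k
        homogeneous k k<1+n us chain φ with m≤n⇒m<n∨m≡n (ℕ.s≤s⁻¹ k<1+n)
        ... | inj₁ k<n = trans (cong (λ ts → type ts φ) (mapᵛ-∘ b f us))
              (trans (hom k k<n (Vec.map f us) (chain-map mono-f chain) φ)
                     (cong (λ p → p φ) (sym (set-there ps n q k<n))))
        ... | inj₂ refl = trans (cong (λ ts → type ts φ)
                (trans (mapᵛ-∘ b f us) (cong (Vec.map b) (mapᵛ-∘ e include us))))
              (trans (homₙ (Vec.map include us) (chain-map include-monotone chain) φ)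
                     (cong (λ p → p φ) (sym (set-here ps n q))))

      abstract
        -- If each colour q failed for some trees, then so would all colours at once for
        -- the disjoint union of these kinds of trees.
        large-suc : ∀ n ps → Large n ps → Σ (Type n) λ q → Large (suc n) (set ps n q)
        large-suc n ps large = decidable-stable em λ none →
          let small-S : ∀ q → Σ (Set ℓ) λ S → ¬ (∀ P → Realised (suc n) (set ps n q) S P)
              small-S q = ¬∀⇒∃¬ λ h → none (q , h)
              small-P : ∀ q → Σ (proj₁ (small-S q) → Set ℓ) λ P → ¬ Realised (suc n) (set ps n q) _ P
              small-P q = ¬∀⇒∃¬ (proj₂ (small-S q))
              q , realised = pigeonhole n ps large (proj₁ ∘ small-S) (proj₁ ∘ small-P)
          in proj₂ (small-P q) realised

      palette : ∀ n → Σ Colours (Large n)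
      palette zero    = (λ _ _ → false) , λ _ _ → free , free-free , λ _ ()
      palette (suc n) = let ps , large = palette n ; q , large′ = large-suc n ps large
                        in set ps n q , large′

      -- Each step of `palette` sets one entry and keeps the earlier ones, so the diagonal collects
      -- their final values.
      limitColours : Colours
      limitColours k = proj₁ (palette (suc k)) k

      palette-stable : ∀ {k} n → k < n → proj₁ (palette n) k ≡ limitColours k
      palette-stable {k} (suc n) k<1+n with m≤n⇒m<n∨m≡n (ℕ.s≤s⁻¹ k<1+n)
      ... | inj₁ k<n  = trans (set-there _ n _ k<n) (palette-stable n k<n)
      ... | inj₂ refl = refl

      FreeSeq : (ℕ → Tuple M σ) → Set (lsuc ℓ ⊔ r)
      FreeSeq b = ∀ n → a ≈ b n × range M (b n) ⫝⟨ C ⟩ (D ∪ Earlier b n)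

      Nice : ℕ → (ℕ → Tuple M σ) → Set (lsuc ℓ ⊔ r)
      Nice m b = FreeSeq b × (∀ k → k < m → (ns : Vec ℕ k) → AllPairs (λ v u → u < v) ns →
                              type (Vec.map b ns) ≈ᵗ limitColours k)

      nice : ∀ m → Σ (ℕ → Tuple M σ) (Nice m)
      nice m with b , freeB , hom ← proj₂ (palette m) (Lift ℓ ℕ) _ = b ∘ stage ,
        (λ n → let a≈ , ⫝ = freeB (stage n) in a≈ ,
          monotonicity (small-range _) (small-∪ sD (small-Below b (stage n))) sC ⫝ id
            (Sum.map id λ (i , i<n , x∈) → stage i , stage-monotone i<n , x∈)) ,
        λ k k<m ns desc φ → trans (cong (λ ts → type ts φ) (mapᵛ-∘ b stage ns))
          (trans (hom k k<m (Vec.map stage ns) (stages desc) φ)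
                 (cong (λ p → p φ) (palette-stable m k<m)))
        where
        below : ∀ {v n} {ns : Vec ℕ n} → Allᵛ (_< v) ns → Allᵛ (_◁ stage v) (Vec.map stage ns)
        below []       = []
        below (h ∷ hs) = stage-monotone h ∷ below hs
        stages : ∀ {n} {ns : Vec ℕ n} → AllPairs (λ v u → u < v) ns → Chain (Vec.map stage ns)
        stages []       = []
        stages (h ∷ hs) = below h ∷ stages hs

      nice-≤ : ∀ {m m′ b} → m ≤ m′ → Nice m′ b → Nice m b
      nice-≤ m≤m′ (f , h) = f , λ k k<m → h k (≤-trans k<m m≤m′)

      Increasing : ∀ {n} → (Fin n → ℕ) → Set
      Increasing f = f Preserves _<ᶠ_ ⟶ _<_

      descending : ∀ {n} (f : Fin n → ℕ) → (∀ {i j} → i <ᶠ j → f j < f i) →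
                   AllPairs (λ v u → u < v) (tabulate f)
      descending {zero}  f h = []
      descending {suc n} f h = tabulate⁺ (λ i → h (s≤s z≤n)) ∷ descending (f ∘ suc) (h ∘ s≤s)

      opposite-< : ∀ {n} {i j : Fin n} → i <ᶠ j → opposite j <ᶠ opposite i
      opposite-< {n} {i} {j} i<j = subst₂ _<_ (sym (opposite-prop j)) (sym (opposite-prop i))
        (∸-monoʳ-< (s≤s i<j) (toℕ<n j))

      -- Chains start with their largest entry, index tuples of indiscernibles with their smallest;
      -- this lemma turns one into the other.
      reverse-≼ : ∀ {n} (ts us : Vec (Tuple M σ) n) {x y : Tuple M (σ^ n)} → type ts ≈ᵗ type us →
                  (∀ k i → Vec.lookup ts (opposite k) i ≡ x (k , i)) →
                  (∀ k i → Vec.lookup us (opposite k) i ≡ y (k , i)) → x ⊕ β ≼ y ⊕ β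
      reverse-≼ {n} ts us {x} {y} h hx hy = ≼-reindex g e ex ey (type⇒≼ ts us h)
        where
        g : (Fin n × I) ⊎ E.Index → (Fin n × I) ⊎ E.Index
        g (inj₁ (k , i)) = inj₁ (opposite k , i)
        g (inj₂ j)       = inj₂ j
        e : ∀ q → (σ^ n ⊕ˢ E.sort) (g q) ≡ (σ^ n ⊕ˢ E.sort) q
        e (inj₁ _) = refl
        e (inj₂ _) = refl
        ex : ∀ q → subst Carrier (e q) ((entries ts ⊕ β) (g q)) ≡ (x ⊕ β) q
        ex (inj₁ (k , i)) = hx k i
        ex (inj₂ _)       = refl
        ey : ∀ q → subst Carrier (e q) ((entries us ⊕ β) (g q)) ≡ (y ⊕ β) q
        ey (inj₁ (k , i)) = hy k i
        ey (inj₂ _)       = refl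

      nice-≼ : ∀ {m b b′} → Nice m b → Nice m b′ → ∀ {n} → n < m → (f g : Fin n → ℕ) →
               Increasing f → Increasing g → concat M b f ⊕ β ≼ concat M b′ g ⊕ β
      nice-≼ {b = b} {b′} (_ , h) (_ , h′) {n} n<m f g f< g< =
        reverse-≼ (Vec.map b (rev f)) (Vec.map b′ (rev g))
          (λ φ → trans (h n n<m (rev f) (rev-desc f f<) φ) (sym (h′ n n<m (rev g) (rev-desc g g<) φ)))
          (entry b f) (entry b′ g)
        where
        rev : (Fin n → ℕ) → Vec ℕ n
        rev f = tabulate (λ k → f (opposite k))
        rev-desc : ∀ f → Increasing f → AllPairs (λ v u → u < v) (rev f)
        rev-desc f f< = descending (λ k → f (opposite k)) (λ i<j → f< (opposite-< i<j))
        entry : ∀ b f k i → Vec.lookup (Vec.map b (rev f)) (opposite k) i ≡ b (f k) i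
        entry b f k i = cong (λ t → t i) (trans (lookup-map (opposite k) b (rev f))
          (cong b (trans (lookup∘tabulate (λ k → f (opposite k)) (opposite k))
                         (cong f (opposite-involutive k)))))

      σ^ω : ℕ × I → Sort
      σ^ω (_ , i) = σ i

      all : (ℕ → Tuple M σ) → Tuple M σ^ω
      all b (n , i) = b n i

      -- Nice sequences of different levels need not extend one another, but on a fixed number of
      -- terms their types agree from some level on. This defines the limit type.
      Limit : VFormula (σ^ω ⊕ˢ E.sort) → Set (lsuc ℓ ⊔ r)
      Limit φ = ∃[ m ] ∀ b → Nice m b → all b ⊕ β ⊨ φ

      plug : VFormula (σ^ω ⊕ˢ E.sort) → FormulaOver M D σ^ω
      plug = plugIn β {D} E.member

      -- True lowers Limit, which lives in a universe depending on r, to the one that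
      -- Saturated demands.
      bounded : ∀ {φs} → All (λ φ → Σ _ λ ψ → True (em {P = Limit ψ}) × φ ≡ plug ψ) φs →
                ∃[ m ] ∀ b → Nice m b → All (λ φ → Holds M φ (all b)) φs
      bounded [] = 0 , λ _ _ → []
      bounded ((ψ , t , refl) ∷ hs) =
        let m , h = toWitness t ; m′ , h′ = bounded hs in m ℕ.⊔ m′ , λ b nb →
          to (Holds-plugIn β {D} E.member ψ (all b)) (h b (nice-≤ (m≤m⊔n m m′) nb)) ∷
          h′ b (nice-≤ (m≤n⊔m m m′) nb)

    abstract
      sequence : ℕ → Tuple M σ
      sequence n i = proj₁ (saturated sD _ λ φs hs → let m , h = bounded hs ; b , nb = nice m in
                                                     all b , h b nb) (n , i)

      private
        sequence-limit : ∀ ψ → Limit ψ → all sequence ⊕ β ⊨ ψ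
        sequence-limit ψ l = from (Holds-plugIn β {D} E.member ψ (all sequence))
          (proj₂ (saturated sD _ λ φs hs → let m , h = bounded hs ; b , nb = nice m in
                                           all b , h b nb) (ψ , fromWitness l , refl))

    private
      -- If `φ` fails in `b`, homogeneity makes it fail in every sequence of the same level, so its
      -- negation is in the limit type.
      prefix : ∀ n {m b} → n < m → Nice m b → concat M sequence {n} toℕ ⊕ β ≼ concat M b toℕ ⊕ β
      prefix n {m} {b} n<m nb φ sφ = decidable-stable em λ ¬bφ →
        lower (sequence-limit (negate (reindex {σ′ = σ^ω ⊕ˢ E.sort} g e φ))
          (m , λ b′ nb′ b′φ → contradiction
            (nice-≼ nb′ nb n<m toℕ toℕ id id φ (from (reindexed b′) b′φ)) ¬bφ)
          (to (reindexed sequence) sφ))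
        where
        g : (Fin n × I) ⊎ E.Index → (ℕ × I) ⊎ E.Index
        g (inj₁ (k , i)) = inj₁ (toℕ k , i)
        g (inj₂ j)       = inj₂ j
        e : ∀ q → (σ^ω ⊕ˢ E.sort) (g q) ≡ (σ^ n ⊕ˢ E.sort) q
        e (inj₁ _) = refl
        e (inj₂ _) = refl
        h : ∀ b q → subst Carrier (e q) ((all b ⊕ β) (g q)) ≡ (concat M b toℕ ⊕ β) q
        h b (inj₁ _) = refl
        h b (inj₂ _) = refl
        reindexed : ∀ b → concat M b toℕ ⊕ β ⊨ φ ⇔ all b ⊕ β ⊨ reindex {σ′ = σ^ω ⊕ˢ E.sort} g e φ
        reindexed b = ⊨-reindex {σ′ = σ^ω ⊕ˢ E.sort} g e φ λ {q} _ → h b q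

      Approximation : ℕ → (ℕ → Tuple M σ) → Set (lsuc ℓ)
      Approximation n b = Σ (Automorphism M) λ α →
        Fixes α D × (∀ {k} → k < n → ∀ i → act α (sequence k i) ≡ b k i)

      approximate : ∀ n {m b} → n < m → Nice m b → Approximation n b
      approximate n {b = b} n<m nb = let α , fix , h = ≼⇒fixes E (prefix n n<m nb) in α , fix ,
        λ k<n i → subst (λ k → act α (sequence k i) ≡ b k i) (toℕ-fromℕ< k<n) (h (fromℕ< k<n , i))

      bound : ∀ {n} (f : Fin n → ℕ) → ∃[ m ] ∀ k → f k < m
      bound {zero}  f = 0 , λ ()
      bound {suc n} f = let m , h = bound (f ∘ suc) in suc (f zero) ℕ.⊔ m ,
        λ { zero → m≤m⊔n _ m ; (suc k) → ≤-trans (h k) (m≤n⊔m (suc (f zero)) m) }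

    private
      sequence-≼ : ∀ {n N m b} → Nice m b → n < m → Approximation N b → (f g : Fin n → ℕ) →
                   Increasing f → Increasing g → (∀ k → f k < N) → (∀ k → g k < N) →
                   concat M sequence f ⊕ β ≼ concat M sequence g ⊕ β
      sequence-≼ {b = b} nb n<m (α , fix , h) f g f< g< f<N g<N φ sφ =
        ≼-sym (moved g g<N) φ (nice-≼ nb nb n<m f g f< g< φ (moved f f<N φ sφ))
        where
        moved : ∀ f → (∀ k → f k < _) → concat M sequence f ⊕ β ≼ concat M b f ⊕ β
        moved f f<N = fixes⇒≼ E α fix λ (k , i) → h (f<N k) i

    -- Both index tuples are transported to one nice sequence that is homogeneous for their length.
    sequence-indiscernible : Indiscernible M D sequence
    sequence-indiscernible n f g f< g< =
      let m , f<m = bound f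
          m′ , g<m′ = bound g
          N = m ℕ.⊔ m′
          -- The level must exceed the length `n` for homogeneity and the bound `N` on the indices
          -- for the approximation.
          b , nb = nice (suc (n + N))
          γ , fixγ , e = ≼⇒fixes E (sequence-≼ nb (s≤s (m≤m+n n N)) (approximate N (s≤s (m≤n+m N n)) nb)
            f g f< g< (λ k → ≤-trans (f<m k) (m≤m⊔n m m′)) (λ k → ≤-trans (g<m′ k) (m≤n⊔m m m′)))
      in fixes⇒sameType γ fixγ e

    sequence-free : ∀ n → SameType M D a (sequence n) ×
                          range M (sequence n) ⫝⟨ C ⟩ (D ∪ Earlier sequence n)
    sequence-free n =
      -- The first `n + 1` terms have to be approximated, which takes a level above `n + 1`.
      let b , nb = nice (suc (suc n)) in transfer (proj₁ nb n) (approximate (suc n) ≤-refl nb)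
      where
      transfer : ∀ {b} → a ≈ b n × range M (b n) ⫝⟨ C ⟩ (D ∪ Earlier b n) → Approximation (suc n) b →
                 SameType M D a (sequence n) × range M (sequence n) ⫝⟨ C ⟩ (D ∪ Earlier sequence n)
      transfer {b} ((γ , fixγ , e) , ⫝) (α , fix , h) =
        fixes⇒sameType (compose (inverse α) γ)
          (λ d d∈ → trans (cong (apply (inverse α)) (fixγ d d∈)) (fixes-inverse α fix d d∈))
          (λ i → trans (cong (back α) (trans (e i) (sym (h ≤-refl i)))) (back-act α _)) ,
        invariance (small-range _) (small-∪ sD (small-Earlier b n)) sC (inverse α)
          (mapsOnto-inverse α (mapsOnto-range α (h ≤-refl)))
          (mapsOnto-∪ (inverse α) (fixes⇒mapsOnto (inverse α) (fixes-inverse α fix))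
            (mapsOnto-inverse α earlier))
          (fixes⇒mapsOnto (inverse α) (λ c c∈ → fixes-inverse α fix c (C⊆D c∈))) ⫝
        where
        earlier : MapsOnto M α (Earlier sequence n) (Earlier b n)
        earlier = mapsOnto α
          (λ { (k , k<n , i , refl) → k , k<n , i , cong (_ ,_) (sym (h (m<n⇒m<1+n k<n) i)) })
          (λ { (k , k<n , i , refl) → k , k<n , i , cong (_ ,_)
                 (trans (sym (back-act α _)) (cong (back α) (h (m<n⇒m<1+n k<n) i))) })

-- Comparison of trees by rank; Tree Shape (Arity X) is thus a linear preorder in
-- which every family indexed by X has a strict upper bound.
infix 4 _≤ᵣ_ _<ᵣ_
_≤ᵣ_ _<ᵣ_ : ∀ {ℓ} {S : Set ℓ} {P : S → Set ℓ} → Tree S P → Tree S P → Set ℓ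
node s h ≤ᵣ y = ∀ p → h p <ᵣ y
x <ᵣ node s h = ∃[ p ] x ≤ᵣ h p

module _ {ℓ} {S : Set ℓ} {P : S → Set ℓ} where

  ≤<ᵣ-trans : ∀ (x y z : Tree S P) → x ≤ᵣ y → y <ᵣ z → x <ᵣ z
  ≤ᵣ-trans  : ∀ (x y z : Tree S P) → x ≤ᵣ y → y ≤ᵣ z → x ≤ᵣ z
  <≤ᵣ-trans : ∀ (x y z : Tree S P) → x <ᵣ y → y ≤ᵣ z → x <ᵣ z
  ≤<ᵣ-trans x y (node s h) x≤y (p , y≤h) = p , ≤ᵣ-trans x y (h p) x≤y y≤h
  ≤ᵣ-trans (node s h) y z x≤y y≤z p      = <≤ᵣ-trans (h p) y z (x≤y p) y≤z
  <≤ᵣ-trans x (node s h) z (p , x≤h) y≤z = ≤<ᵣ-trans x (h p) z x≤h (y≤z p)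

  <ᵣ⇒≤ᵣ : ∀ (x y : Tree S P) → x <ᵣ y → x ≤ᵣ y
  <ᵣ⇒≤ᵣ (node s h) (node t k) (q , x≤k) p = q , <ᵣ⇒≤ᵣ (h p) (k q) (x≤k p)

  ≤ᵣ-refl : ∀ (x : Tree S P) → x ≤ᵣ x
  ≤ᵣ-refl (node s h) p = p , ≤ᵣ-refl (h p)

  <ᵣ-trans : ∀ (x y z : Tree S P) → x <ᵣ y → y <ᵣ z → x <ᵣ z
  <ᵣ-trans x y z x<y y<z = <≤ᵣ-trans x y z x<y (<ᵣ⇒≤ᵣ y z y<z)

  <ᵣ-irrefl : ∀ (x : Tree S P) → ¬ x <ᵣ x
  <ᵣ-irrefl (node s h) (p , x≤h) = <ᵣ-irrefl (h p) (x≤h p)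

  module _ (em : ∀ {a : Level} → ExcludedMiddle a) where

    ≤ᵣ⊎>ᵣ : ∀ (x y : Tree S P) → x ≤ᵣ y ⊎ y <ᵣ x
    <ᵣ⊎≥ᵣ : ∀ (x y : Tree S P) → x <ᵣ y ⊎ y ≤ᵣ x
    ≤ᵣ⊎>ᵣ (node s h) y with em {P = ∃[ p ] y ≤ᵣ h p}
    ... | yes y<x = inj₂ y<x
    ... | no y≮x  = inj₁ λ p → Sum.fromInj₁ (λ y≤h → contradiction (p , y≤h) y≮x) (<ᵣ⊎≥ᵣ (h p) y)
    <ᵣ⊎≥ᵣ x (node t k) with em {P = ∃[ q ] x ≤ᵣ k q}
    ... | yes x<y = inj₁ x<y
    ... | no x≮y  = inj₂ λ q → Sum.fromInj₂ (λ x≤k → contradiction (q , x≤k) x≮y) (≤ᵣ⊎>ᵣ x (k q))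

    <ᵣ-cotrans : ∀ (x y z : Tree S P) → x <ᵣ z → x <ᵣ y ⊎ y <ᵣ z
    <ᵣ-cotrans x y z x<z = Sum.map id (λ y≤x → ≤<ᵣ-trans y x z y≤x x<z) (<ᵣ⊎≥ᵣ x y)

-- Weak orders and order-preserving positions for finitely many elements.

record IsWeakOrder {ℓ} {K : Set ℓ} (_≺ᴷ_ : K → K → Set ℓ) : Set ℓ where
  field
    irreflexive  : ∀ k → ¬ k ≺ᴷ k
    transitive   : ∀ k l m → k ≺ᴷ l → l ≺ᴷ m → k ≺ᴷ m
    cotransitive : ∀ k l m → k ≺ᴷ m → k ≺ᴷ l ⊎ l ≺ᴷ m

module _ (em : ∀ {a : Level} → ExcludedMiddle a) {ℓ} {S : Set ℓ} {P : S → Set ℓ} where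

  <ᵣ-isWeakOrder : IsWeakOrder {K = Tree S P} _<ᵣ_
  <ᵣ-isWeakOrder = record
    { irreflexive = <ᵣ-irrefl ; transitive = <ᵣ-trans
    ; cotransitive = <ᵣ-cotrans em }

  >ᵣ-isWeakOrder : IsWeakOrder {K = Tree S P} (λ x y → y <ᵣ x)
  >ᵣ-isWeakOrder = record
    { irreflexive = <ᵣ-irrefl ; transitive = λ x y z p q → <ᵣ-trans z y x q p
    ; cotransitive = λ x y z p → Sum.swap (<ᵣ-cotrans em z y x p) }

-- Distinct trees may have equal rank, so the order is only weak; incomparable elements are forced
-- to share a position.
Compatible : ∀ {ℓ} {K : Set ℓ} → (K → K → Set ℓ) → (K → ℕ) → List K → Set ℓ
Compatible _≺ᴷ_ pos ks = ∀ {k l} → k ∈ˡ ks → l ∈ˡ ks → k ≺ᴷ l ⇔ pos k < pos l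

module Counting (em : ∀ {a : Level} → ExcludedMiddle a) {ℓ} {K : Set ℓ} {_≺ᴷ_ : K → K → Set ℓ}
                (order : IsWeakOrder _≺ᴷ_) where
  open IsWeakOrder order

  count : List K → K → ℕ
  count []       k = 0
  count (l ∷ ls) k with em {P = l ≺ᴷ k}
  ... | yes _ = suc (count ls k)
  ... | no _  = count ls k

  count-≤ : ∀ ls {k m} → (∀ {l} → l ≺ᴷ k → l ≺ᴷ m) → count ls k ≤ count ls m
  count-≤ [] h = z≤n
  count-≤ (l ∷ ls) {k} {m} h with em {P = l ≺ᴷ k} | em {P = l ≺ᴷ m}
  ... | yes _ | yes _ = s≤s (count-≤ ls h)
  ... | yes p | no ¬q = contradiction (h p) ¬q
  ... | no _  | yes _ = m≤n⇒m≤1+n (count-≤ ls h)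
  ... | no _  | no _  = count-≤ ls h

  count-< : ∀ ls {k m} → k ≺ᴷ m → k ∈ˡ ls → count ls k < count ls m
  count-< (l ∷ ls) {k} {m} k≺m k∈ with em {P = l ≺ᴷ k} | em {P = l ≺ᴷ m} | k∈
  ... | yes p | no ¬q | _         = contradiction (transitive l k m p k≺m) ¬q
  ... | yes p | yes _ | here refl = contradiction p (irreflexive k)
  ... | yes _ | yes _ | there k∈′ = s≤s (count-< ls k≺m k∈′)
  ... | no _  | yes _ | _         = s≤s (count-≤ ls λ {l} p → transitive l k m p k≺m)
  ... | no _  | no ¬q | here refl = contradiction k≺m ¬q
  ... | no _  | no _  | there k∈′ = count-< ls k≺m k∈′

  count-compatible : ∀ ks → Compatible _≺ᴷ_ (count ks) ks
  -- If `k` is not below `m`, cotransitivity puts everything below `m` also below `k`, so the count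
  -- at `m` is at most that at `k`.
  count-compatible ks {k} {m} k∈ _ = mk⇔ (λ k≺m → count-< ks k≺m k∈) λ c< →
    decidable-stable em λ ¬k≺m → <⇒≱ c< (count-≤ ks λ {l} l≺m →
      Sum.[ id , (λ k≺m → contradiction k≺m ¬k≺m) ] (cotransitive l k m l≺m))

module _ {ℓ} {K : Set ℓ} (pos pos′ : K → ℕ) where

  -- A monotone step function on ℕ that, for compatible positions, sends `pos k` to `pos′ k`.
  maxBelow : List K → ℕ → ℕ
  maxBelow []       n = 0
  maxBelow (k ∷ ks) n with pos k ℕ.≤? n
  ... | yes _ = pos′ k ℕ.⊔ maxBelow ks n
  ... | no _  = maxBelow ks n

  ≤-maxBelow : ∀ {ks n k} → k ∈ˡ ks → pos k ≤ n → pos′ k ≤ maxBelow ks n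
  ≤-maxBelow {l ∷ ks} {n} k∈ k≤n with pos l ℕ.≤? n | k∈
  ... | yes _ | here refl = m≤m⊔n _ _
  ... | yes _ | there k∈′ = ≤-trans (≤-maxBelow k∈′ k≤n) (m≤n⊔m (pos′ l) _)
  ... | no ¬p | here refl = contradiction k≤n ¬p
  ... | no _  | there k∈′ = ≤-maxBelow k∈′ k≤n

  maxBelow-≤ : ∀ ks {n m} → (∀ {k} → k ∈ˡ ks → pos k ≤ n → pos′ k ≤ m) → maxBelow ks n ≤ m
  maxBelow-≤ []       h = z≤n
  maxBelow-≤ (k ∷ ks) {n} h with pos k ℕ.≤? n
  ... | yes p = ⊔-lub (h (here refl) p) (maxBelow-≤ ks (h ∘ there))
  ... | no _  = maxBelow-≤ ks (h ∘ there)

  -- Two compatible position functions are compared through their sum, which is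
  -- obtained from each of them by a strictly increasing function on ℕ.
  stretchBy : List K → ℕ → ℕ
  stretchBy ks n = n + maxBelow ks n

  stretchBy-< : ∀ ks {m n} → m < n → stretchBy ks m < stretchBy ks n
  stretchBy-< ks m<n = +-mono-<-≤ m<n
    (maxBelow-≤ ks λ k∈ k≤m → ≤-maxBelow k∈ (≤-trans k≤m (<⇒≤ m<n)))

  stretchBy-pos : ∀ {_≺ᴷ_ : K → K → Set ℓ} {ks} → Compatible _≺ᴷ_ pos ks → Compatible _≺ᴷ_ pos′ ks →
                  ∀ {k} → k ∈ˡ ks → stretchBy ks (pos k) ≡ pos k + pos′ k
  stretchBy-pos {ks = ks} c c′ {k} k∈ = cong (pos k +_) (≤-antisym
    (maxBelow-≤ ks λ l∈ l≤k → ≮⇒≥ λ k<l → <⇒≱ (to (c k∈ l∈) (from (c′ k∈ l∈) k<l)) l≤k)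
    (≤-maxBelow k∈ ≤-refl))

-- Stretching an indiscernible sequence along a weak order.

module Stretching (em : ∀ {a : Level} → ExcludedMiddle a) {ℓ : Level} {L : Signature ℓ}
         {T : Theory L} (𝕄 : BigModel T) {D : Subset (BigModel.structure 𝕄)}
         (sD : Small (BigModel.structure 𝕄) D) {I : Set ℓ} {σ : I → Signature.Sort L}
         (b : ℕ → Tuple (BigModel.structure 𝕄) σ) (ind : Indiscernible (BigModel.structure 𝕄) D b)
         {K : Set ℓ} {_≺ᴷ_ : K → K → Set ℓ} (order : IsWeakOrder _≺ᴷ_) where
  open Big em 𝕄
  open Signature L
  open Structure M
  open Counting em order

  private
    E = enumerate sD
    module E = Enumeration E
    β = E.tuple

    σᴷ : K × I → Sort
    σᴷ (_ , i) = σ i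

    at : (K → ℕ) → Tuple M σᴷ
    at pos (k , i) = b (pos k) i

    keys : VFormula (σᴷ ⊕ˢ E.sort) → List K
    keys (vs , _) = map proj₁ (lefts vs)

    positions-bounded : ∀ (pos : K → ℕ) ks → ∃[ n ] ∀ {k} → k ∈ˡ ks → pos k ≤ n
    positions-bounded pos []       = 0 , λ ()
    positions-bounded pos (k ∷ ks) = let n , h = positions-bounded pos ks in pos k ℕ.⊔ n ,
      λ { (here refl) → m≤m⊔n _ n ; (there k∈) → ≤-trans (h k∈) (m≤n⊔m (pos k) n) }

    reposition : ∀ φ {pos pos′} (f : ℕ → ℕ) → (∀ {m n} → m < n → f m < f n) →
                 (∀ {k} → k ∈ˡ keys φ → f (pos k) ≡ pos′ k) →
                 at pos ⊕ β ⊨ φ ⇔ at pos′ ⊕ β ⊨ φ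
    reposition φ {pos} {pos′} f f< fpos = mk⇔
      (λ h → from later (sameType⇒≼ β {D} E.member same (reindex {σ′ = σᶠ ⊕ˢ E.sort} g e φ) (to now h)))
      (λ h → from now (≼-sym (sameType⇒≼ β {D} E.member same) (reindex {σ′ = σᶠ ⊕ˢ E.sort} g e φ)
                         (to later h)))
      where
      n = proj₁ (positions-bounded pos (keys φ))
      σᶠ : Fin (suc n) × I → Sort
      σᶠ (_ , i) = σ i
      -- Keys outside `φ` may have larger positions; these are cut off, without effect on the keys
      -- that occur.
      clamp : K → Fin (suc n)
      clamp k = fromℕ< (s≤s (m⊓n≤n (pos k) n))
      toℕ-clamp : ∀ {k} → k ∈ˡ keys φ → toℕ (clamp k) ≡ pos k
      toℕ-clamp k∈ = trans (toℕ-fromℕ< _) (m≤n⇒m⊓n≡m (proj₂ (positions-bounded pos (keys φ)) k∈))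
      g : (K × I) ⊎ E.Index → (Fin (suc n) × I) ⊎ E.Index
      g (inj₁ (k , i)) = inj₁ (clamp k , i)
      g (inj₂ j)       = inj₂ j
      e : ∀ q → (σᶠ ⊕ˢ E.sort) (g q) ≡ (σᴷ ⊕ˢ E.sort) q
      e (inj₁ _) = refl
      e (inj₂ _) = refl
      same : SameType M D (concat M b {suc n} toℕ) (concat M b (λ k → f (toℕ k)))
      same = ind (suc n) toℕ (λ k → f (toℕ k)) id f<
      key : ∀ {k i vs} → inj₁ (k , i) ∈ˡ vs → k ∈ˡ map proj₁ (lefts {Q = K × I} {Q′ = E.Index} vs)
      key p = ∈-map⁺ proj₁ (∈-lefts p)
      correct : ∀ (f : ℕ → ℕ) {pos′} → (∀ {k} → k ∈ˡ keys φ → f (pos k) ≡ pos′ k) → ∀ {q} → q ∈ˡ proj₁ φ →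
        subst Carrier (e q) ((concat M b {suc n} (λ k → f (toℕ k)) ⊕ β) (g q)) ≡ (at pos′ ⊕ β) q
      correct f h {inj₁ (k , i)} p = cong (λ m → b m i) (trans (cong f (toℕ-clamp (key p))) (h (key p)))
      correct f h {inj₂ j} p = refl
      now : at pos ⊕ β ⊨ φ ⇔ concat M b {suc n} toℕ ⊕ β ⊨ reindex {σ′ = σᶠ ⊕ˢ E.sort} g e φ
      now = ⊨-reindex {σ′ = σᶠ ⊕ˢ E.sort} g e φ (correct id (λ _ → refl))
      later : at pos′ ⊕ β ⊨ φ ⇔
              concat M b {suc n} (λ k → f (toℕ k)) ⊕ β ⊨ reindex {σ′ = σᶠ ⊕ˢ E.sort} g e φ
      later = ⊨-reindex {σ′ = σᶠ ⊕ˢ E.sort} g e φ (correct f fpos)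

    position-irrelevant : ∀ φ {pos pos′} → Compatible _≺ᴷ_ pos (keys φ) →
                          Compatible _≺ᴷ_ pos′ (keys φ) → at pos ⊕ β ⊨ φ → at pos′ ⊕ β ⊨ φ
    position-irrelevant φ {pos} {pos′} c c′ h =
      from (reposition φ {pos = pos′} {pos′ = λ k → pos k + pos′ k}
             (stretchBy pos′ pos (keys φ)) (stretchBy-< pos′ pos (keys φ))
             λ {k} k∈ → trans (stretchBy-pos pos′ pos {_≺ᴷ_ = _≺ᴷ_} c′ c k∈) (+-comm (pos′ k) (pos k)))
        (to (reposition φ {pos = pos} {pos′ = λ k → pos k + pos′ k}
              (stretchBy pos pos′ (keys φ)) (stretchBy-< pos pos′ (keys φ))
              λ k∈ → stretchBy-pos pos pos′ {_≺ᴷ_ = _≺ᴷ_} c c′ k∈) h)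

    -- All compatible positions agree on `φ`, so either `φ` or its negation is eventual: the type to
    -- be realised is complete.
    Eventual : VFormula (σᴷ ⊕ˢ E.sort) → Set (lsuc ℓ)
    Eventual φ = ∀ pos → Compatible _≺ᴷ_ pos (keys φ) → at pos ⊕ β ⊨ φ

    compatible-⊆ : ∀ {pos} {ks ls : List K} → (∀ {k} → k ∈ˡ ks → k ∈ˡ ls) →
                   Compatible _≺ᴷ_ pos ls → Compatible _≺ᴷ_ pos ks
    compatible-⊆ h c k∈ l∈ = c (h k∈) (h l∈)

    p : Pred (FormulaOver M D σᴷ) (lsuc ℓ)
    p φ = Σ (VFormula (σᴷ ⊕ˢ E.sort)) λ ψ → Eventual ψ × φ ≡ plugIn β {D} E.member ψ

    allKeys : ∀ {φs} → All (_∈ᴾ p) φs → List K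
    allKeys []                  = []
    allKeys ((ψ , _) ∷ hs)      = keys ψ ++ allKeys hs

    satisfied : ∀ {φs} (hs : All (_∈ᴾ p) φs) {pos} → Compatible _≺ᴷ_ pos (allKeys hs) →
                All (λ φ → Holds M φ (at pos)) φs
    satisfied [] c = []
    satisfied ((ψ , h , refl) ∷ hs) {pos} c =
      to (Holds-plugIn β {D} E.member ψ (at pos)) (h pos (compatible-⊆ {pos} ∈-++⁺ˡ c)) ∷
      satisfied hs (compatible-⊆ {pos} (∈-++⁺ʳ (keys ψ)) c)

    realisation : Σ (Tuple M σᴷ) λ c → ∀ {φ} → φ ∈ᴾ p → Holds M φ c
    realisation = saturated sD p λ φs hs → at (count (allKeys hs)) ,
      satisfied hs (count-compatible (allKeys hs))

  abstract
    stretched : K → Tuple M σ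
    stretched k i = proj₁ realisation (k , i)

    -- The only access to the stretched family from here on; through it invariance carries
    -- independence over from `b`.
    align : ∀ ks → Σ (K → ℕ) λ pos → Compatible _≺ᴷ_ pos ks ×
              Σ (Automorphism M) λ α → Fixes α D ×
                (∀ {k} → k ∈ˡ ks → ∀ i → act α (stretched k i) ≡ b (pos k) i)
    align ks = pos , compatible ,
      let α , fix , h = ≼⇒fixes E {x = λ (k , i) → stretched (proj₁ k) i}
                                  {y = λ (k , i) → b (pos (proj₁ k)) i} below
      in α , fix , λ k∈ i → h ((_ , k∈) , i)
      where
      pos : K → ℕ
      pos = count ks
      compatible : Compatible _≺ᴷ_ pos ks
      compatible = count-compatible ks

      Key : Set ℓ
      Key = Σ K (_∈ˡ ks)

      σₖ : Key × I → Sort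
      σₖ (_ , i) = σ i

      g : (Key × I) ⊎ E.Index → (K × I) ⊎ E.Index
      g (inj₁ (k , i)) = inj₁ (proj₁ k , i)
      g (inj₂ j)       = inj₂ j

      e : ∀ q → (σᴷ ⊕ˢ E.sort) (g q) ≡ (σₖ ⊕ˢ E.sort) q
      e (inj₁ _) = refl
      e (inj₂ _) = refl

      restrict : (y : Tuple M σᴷ) → Tuple M σₖ
      restrict y (k , i) = y (proj₁ k , i)

      correct : ∀ y q → subst Carrier (e q) ((y ⊕ β) (g q)) ≡ (restrict y ⊕ β) q
      correct y (inj₁ _) = refl
      correct y (inj₂ _) = refl

      keys-⊆ : ∀ vs {k} → k ∈ˡ map proj₁ (lefts (map g vs)) → k ∈ˡ ks
      keys-⊆ (inj₁ ((_ , k∈) , _) ∷ vs) (here refl) = k∈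
      keys-⊆ (inj₁ _ ∷ vs) (there q)                = keys-⊆ vs q
      keys-⊆ (inj₂ _ ∷ vs) q                        = keys-⊆ vs q

      below : (restrict (λ (k , i) → stretched k i) ⊕ β) ≼ (restrict (at pos) ⊕ β)
      -- A formula false at `pos` has an eventual negation, which the stretched family satisfies.
      below ψ h = decidable-stable em λ ¬h →
        let φ = reindex {σ′ = σᴷ ⊕ˢ E.sort} g e ψ
            reindexed : ∀ y → restrict y ⊕ β ⊨ ψ ⇔ y ⊕ β ⊨ φ
            reindexed y = ⊨-reindex {σ′ = σᴷ ⊕ˢ E.sort} g e ψ λ {q} _ → correct y q
            false : Eventual (negate φ)
            false pos′ c′ = position-irrelevant (negate φ) {pos} {pos′}
              (compatible-⊆ {pos} (keys-⊆ (proj₁ ψ)) compatible) c′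
              λ hφ → contradiction (from (reindexed (at pos)) hφ) ¬h
        in lower (from (Holds-plugIn β {D} E.member (negate φ) (proj₁ realisation))
                       (proj₂ realisation (negate φ , false , refl))
                       (to (reindexed (proj₁ realisation)) h))

  stretched-realises : ∀ {a : Tuple M σ} → (∀ n → SameType M D a (b n)) → ∀ k →
    Σ (Automorphism M) λ δ → Fixes δ D × (∀ i → act δ (stretched k i) ≡ a i)
  stretched-realises {a} same k =
    let pos , _ , α , fixα , e = align (k ∷ [])
        γ , fixγ , h = sameType⇒fixes E (same (pos k))
    in compose (inverse γ) α ,
       (λ d d∈ → trans (cong (apply (inverse γ)) (fixα d d∈)) (fixes-inverse γ fixγ d d∈)) ,
       λ i → trans (cong (back γ) (trans (e (here refl) i) (sym (h i)))) (back-act γ (a i))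

-- Symmetry of independence.

module Symmetry (em : ∀ {a : Level} → ExcludedMiddle a) {ℓ r : Level} {L : Signature ℓ}
         {T : Theory L} (𝕄 : BigModel T)
         (_⫝⟨_⟩_ : Ternary (BigModel.structure 𝕄) r)
         (isInd : IsIndependence (BigModel.structure 𝕄) _⫝⟨_⟩_) where
  open Big em 𝕄
  open Signature L
  open Structure M
  open IsIndependence isInd
  open Independence em 𝕄 _⫝⟨_⟩_ isInd

  private variable
    A B C X : Subset M

  Between : ∀ {I : Set ℓ} {σ : I → Sort} → (ℕ → Tuple M σ) → ℕ → ℕ → Subset M
  Between b n k x = ∃[ m ] (n < m × m < k) × x ∈ᴾ range M (b m)

  small-Between : ∀ {I : Set ℓ} {σ : I → Sort} (b : ℕ → Tuple M σ) n k → Small M (Between b n k)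
  small-Between b n k = small-⊆ (λ (m , (_ , m<k) , x∈) → m , m<k , x∈) (small-Earlier b k)

  -- Induction on `k`: enlarging the base in `free k` by the terms in between makes `b k`
  -- independent of `b n` over them, and left transitivity adjoins it.
  later⫝ : ∀ {I : Set ℓ} {σ : I → Sort} (b : ℕ → Tuple M σ) → Small M C →
           (∀ n → range M (b n) ⫝⟨ C ⟩ Earlier b n) →
           ∀ n k → Between b n k ⫝⟨ C ⟩ range M (b n)
  later⫝ {C} b sC free n zero =
    -- The left side is empty here; any instance of `free` with `b n` on the right serves.
    monotonicity (small-range (b (suc n))) (small-Earlier b (suc n)) sC (free (suc n))
      (λ { (_ , (_ , ()) , _) }) (λ x∈ → n , ≤-refl , x∈)
  later⫝ {C} b sC free n (suc k) with n ℕ.<? k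
  ... | no n≮k = monotonicity (small-Between b n k) (small-range (b n)) sC (later⫝ b sC free n k)
          (λ (m , (n<m , m<1+k) , _) → contradiction (<-≤-trans n<m (ℕ.s≤s⁻¹ m<1+k)) n≮k) id
  ... | yes n<k =
    monotonicity (small-∪ (small-Between b n k) (small-range (b k))) (small-range (b n)) sC
      (leftTransitivity (small-range (b n)) sC (small-Between b n k) (small-range (b k))
        (later⫝ b sC free n k)
        (monotonicity (small-range (b k)) (small-Earlier b k) (small-∪ sC (small-Between b n k))
          (enlargeBase (small-range (b k)) (small-Earlier b k) sC inj₁
            Sum.[ inj₂ , (λ (m , (_ , m<k) , x∈) → inj₁ (m , m<k , x∈)) ] (free k))
          id λ x∈ → n , n<k , x∈))
      split id
    where
    split : Between b n (suc k) ⊆ Between b n k ∪ range M (b k)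
    split (m , (n<m , m<1+k) , x∈) with m≤n⇒m<n∨m≡n (ℕ.s≤s⁻¹ m<1+k)
    ... | inj₁ m<k  = inj₁ (m , (n<m , m<k) , x∈)
    ... | inj₂ refl = inj₂ x∈

  -- Local character makes B independent of one member of a sufficiently long
  -- family over some of the other members, all of them strictly below it.
  module LongFamily {B : Subset M} (sB : Small M B) where
    private κ = proj₁ (localCharacter sB)

    Long : Set ℓ
    Long = Tree Shape (Arity κ)

    Members : ∀ {I : Set ℓ} {σ : I → Sort} → (Long → Tuple M σ) → (κ → Long) → Subset M
    Members c f x = ∃[ p ] x ∈ᴾ range M (c (f p))

    small-Members : ∀ {I : Set ℓ} {σ : I → Sort} (c : Long → Tuple M σ) f → Small M (Members c f)
    small-Members {I} {σ} c f = (κ × I) , (λ (p , i) → σ i , c (f p) i) , λ (p , i , e) → (p , i) , e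

    reflect : ∀ {I : Set ℓ} {σ : I → Sort} (c : Long → Tuple M σ) → Small M C →
              Σ (κ → Long) λ f → B ⫝⟨ C ∪ Members c f ⟩ range M (c (node branch f))
    reflect {C} {I} {σ} c sC = f , monotonicity sB sV
        (small-∪ sC (small-Members c f))
        (baseMonotonicity sB sV covered (Sum.map id λ (p , x∈) → f p , x∈) B⫝V)
        id (λ x∈ → inj₂ (_ , x∈))
      where
      -- All members enter `V`, so the one at `node branch f` is among them although `f` is found
      -- only afterwards.
      V : Subset M
      V = C ∪ (λ x → ∃[ u ] x ∈ᴾ range M (c u))

      sV : Small M V
      sV = small-∪ sC ((Long × I) , (λ (u , i) → σ i , c u i) , λ (u , i , e) → (u , i) , e)

      local = proj₂ (localCharacter sB) sV
      E = proj₁ local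
      E⊆V = proj₁ (proj₂ local)
      code = proj₁ (proj₁ (proj₁ (proj₂ (proj₂ local))))
      code-injective = proj₂ (proj₁ (proj₁ (proj₂ (proj₂ local))))
      B⫝V = proj₂ (proj₂ (proj₂ local))

      Coded : κ → Set _
      Coded p = Σ Long λ u → ∃[ x ] Σ (x ∈ᴾ E) λ x∈ → code x x∈ ≡ p × x ∈ᴾ range M (c u)

      choose : ∀ {p} → Dec (Coded p) → Long
      choose (yes (u , _)) = u
      choose (no _)        = node leaf λ ()

      f : κ → Long
      f p = choose (em {P = Coded p})

      chosen : ∀ {x} (x∈ : x ∈ᴾ E) → ∃[ u ] x ∈ᴾ range M (c u) →
               (d : Dec (Coded (code x x∈))) → x ∈ᴾ range M (c (choose d))
      chosen x∈ (u , x∈c) (no n) = contradiction (u , _ , x∈ , refl , x∈c) n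
      chosen x∈ _ (yes (u , y , y∈ , e , y∈c)) = subst (_∈ᴾ range M (c u)) (code-injective y∈ x∈ e) y∈c

      covered : E ⊆ C ∪ Members c f
      covered x∈ = Sum.map id (λ x∈c → code _ x∈ , chosen x∈ x∈c em) (E⊆V x∈)

    module _ {C D : Subset M} (C⊆D : C ⊆ D) (sD : Small M D) {I : Set ℓ} {σ : I → Sort}
             (b : ℕ → Tuple M σ) (ind : Indiscernible M D b)
             {_≺ᴷ_ : Long → Long → Set ℓ} (order : IsWeakOrder _≺ᴷ_) (f : κ → Long) where
      open Stretching em 𝕄 sD b ind order

      -- Finite character leaves finitely many members, and `align` moves these over `D` to terms of
      -- `b`, where the hypothesis applies.
      members⫝ : ∀ {k} → (∀ pos ps → Compatible _≺ᴷ_ pos (k ∷ map f ps) →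
          (λ x → ∃[ p ] p ∈ˡ ps × x ∈ᴾ range M (b (pos (f p)))) ⫝⟨ C ⟩ range M (b (pos k))) →
        Members stretched f ⫝⟨ C ⟩ range M (stretched k)
      members⫝ {k} hyp = finiteCharacter (small-Members stretched f) (small-range (stretched k)) sC finite
        where
        sC = small-⊆ C⊆D sD

        indices : ∀ {xs} → All (_∈ᴾ Members stretched f) xs → Σ (List κ) λ ps →
                  All (λ x → ∃[ p ] p ∈ˡ ps × x ∈ᴾ range M (stretched (f p))) xs
        indices [] = [] , []
        indices ((p , x∈) ∷ hs) = let ps , h = indices hs in
          p ∷ ps , (p , here refl , x∈) ∷ All.map (λ (q , q∈ , y∈) → q , there q∈ , y∈) h

        finite : ∀ xs → All (_∈ᴾ Members stretched f) xs → (_∈ˡ xs) ⫝⟨ C ⟩ range M (stretched k)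
        finite xs xs∈ =
          let ps , h = indices xs∈
              pos , compat , α , fix , e = align (k ∷ map f ps)
              target : Subset M
              target = λ x → ∃[ p ] p ∈ˡ ps × x ∈ᴾ range M (b (pos (f p)))
              -- A full preimage, so that surjectivity onto `target` is automatic; monotonicity then
              -- cuts it down to `xs`.
              source : Subset M
              source = λ x → apply α x ∈ᴾ target
              onto : MapsOnto M α source target
              onto = mapsOnto α id (λ {y} y∈ → subst (_∈ᴾ target) (sym (apply-back α y)) y∈)
              image : ∀ {x} → ∃[ p ] p ∈ˡ ps × x ∈ᴾ range M (stretched (f p)) → x ∈ᴾ source
              image = λ { (p , p∈ , i , refl) → p , p∈ , i , cong (_ ,_) (sym (e (there (∈-map⁺ f p∈)) i)) }
              sTarget : Small M target
              sTarget = (κ × I) , (λ (p , i) → σ i , b (pos (f p)) i) , λ (p , _ , i , x≡) → (p , i) , x≡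
          in monotonicity (small-image (inverse α) (mapsOnto-inverse α onto) sTarget)
               (small-range (stretched k)) sC
               (invariance sTarget (small-range (b (pos k))) sC (inverse α) (mapsOnto-inverse α onto)
                 (mapsOnto-inverse α (mapsOnto-range α (e (here refl))))
                 (fixes⇒mapsOnto (inverse α) (λ x x∈ → fixes-inverse α fix x (C⊆D x∈)))
                 (hyp pos ps compat))
               (λ x∈ → image (All.lookup h x∈)) id

  -- Types are taken over `B ∪ C`, and not only over `C`, so that the member found can be carried to
  -- `A` by an automorphism that fixes `B` as well.
  symmetry : Small M A → Small M B → Small M C → A ⫝⟨ C ⟩ B → B ⫝⟨ C ⟩ A
  symmetry {A} {B} {C} sA sB sC A⫝B =
    invariance sB (small-range (c top)) sC δ (fixed inj₁) A-onto (fixed inj₂) B⫝top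
    where
    D : Subset M
    D = B ∪ C
    sD = small-∪ sB sC
    EA = enumerate sA
    module EA = Enumeration EA
    a = EA.tuple

    a⫝D : range M a ⫝⟨ C ⟩ D
    a⫝D = monotonicity sA sD sC (addBase-right sA sB sC A⫝B) (λ { (i , refl) → EA.member i }) id

    module Ext = Extraction a (λ x → inj₂ x) sD a⫝D
    b = Ext.sequence

    free : ∀ n → range M (b n) ⫝⟨ C ⟩ Earlier b n
    free n = monotonicity (small-range (b n)) (small-∪ sD (small-Earlier b n)) sC
               (proj₂ (Ext.sequence-free n)) id inj₂

    open LongFamily sB
    order : IsWeakOrder {K = Long} λ x y → y <ᵣ x
    order = >ᵣ-isWeakOrder em
    module Str = Stretching em 𝕄 sD b Ext.sequence-indiscernible order

    c : Long → Tuple M _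
    c = Str.stretched

    f = proj₁ (reflect c sC)
    top : Long
    top = node branch f

    bound : ∀ (pos : Long → ℕ) ps → ∃[ k ] ∀ {p} → p ∈ˡ ps → pos (f p) < k
    bound pos []       = 0 , λ ()
    bound pos (p ∷ ps) = let k , h = bound pos ps in suc (pos (f p)) ℕ.⊔ k ,
      λ { (here refl) → m≤m⊔n _ k ; (there p∈) → ≤-trans (h p∈) (m≤n⊔m (suc (pos (f p))) k) }

    members⫝top : Members c f ⫝⟨ C ⟩ range M (c top)
    members⫝top = members⫝ inj₂ sD b Ext.sequence-indiscernible order f {top} λ pos ps compat →
      let k , pos< = bound pos ps in
      monotonicity (small-Between b (pos top) k) (small-range (b (pos top))) sC
        (later⫝ b sC free (pos top) k)
        (λ (p , p∈ , x∈) → pos (f p) ,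
          (to (compat (here refl) (there (∈-map⁺ f p∈))) (p , ≤ᵣ-refl (f p)) , pos< p∈) , x∈)
        id

    B⫝top : B ⫝⟨ C ⟩ range M (c top)
    B⫝top = monotonicity (small-∪ (small-Members c f) sB) (small-range (c top)) sC
      (leftTransitivity (small-range (c top)) sC (small-Members c f) sB members⫝top
        (proj₂ (reflect c sC))) inj₂ id

    conjugate = Str.stretched-realises {a = a} (λ n → proj₁ (Ext.sequence-free n)) top
    δ = proj₁ conjugate

    fixed : X ⊆ D → MapsOnto M δ X X
    fixed X⊆D = fixes⇒mapsOnto δ λ x x∈ → proj₁ (proj₂ conjugate) x (X⊆D x∈)

    A-onto : MapsOnto M δ (range M (c top)) A
    A-onto = let f , g = mapsOnto-range δ {x = c top} {y = a} (proj₂ (proj₂ conjugate)) in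
      (λ x∈ → let i , e = f x∈ in subst A e (EA.member i)) , λ y∈ → g (EA.index y∈)

-- Weak canonical bases.

module WeakCanonicalBases (em : ∀ {a : Level} → ExcludedMiddle a) {ℓ r : Level} {L : Signature ℓ}
         {T : Theory L} (𝕄 : BigModel T)
         (_⫝⟨_⟩_ : Ternary (BigModel.structure 𝕄) r)
         (strict : IsStrict (BigModel.structure 𝕄) _⫝⟨_⟩_) where
  open Big em 𝕄
  open Signature L
  open Structure M
  open IsStrict strict
  open IsIndependence isIndependence
  open Independence em 𝕄 _⫝⟨_⟩_ isIndependence
  open Symmetry em 𝕄 _⫝⟨_⟩_ isIndependence

  private variable
    A B C D : Subset M

  rightTransitivity : Small M A → Small M B → Small M C → Small M D → D ⊆ C → C ⊆ B →
                      A ⫝⟨ C ⟩ B → A ⫝⟨ D ⟩ C → A ⫝⟨ D ⟩ B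
  rightTransitivity sA sB sC sD D⊆C C⊆B A⫝B A⫝C =
    symmetry sB sA sD (transitivity sA sB D⊆C C⊆B (symmetry sA sB sC A⫝B) (symmetry sA sC sD A⫝C))

  -- Symmetry lets `acl-right` close both sides; a common element is then independent of itself over
  -- `C`.
  acl-∩ : Small M A → Small M B → Small M C → A ⫝⟨ C ⟩ B →
          acl M (A ∪ C) ∩ acl M (B ∪ C) ⊆ acl M C
  acl-∩ {A} {B} {C} sA sB sC A⫝B (d∈A , d∈B) = antiReflexivity sC
    (monotonicity sA′ sB′ sC
      (symmetry sB′ sA′ sC (acl-right sB′ sA sC (symmetry sA sB′ sC (acl-right sA sB sC A⫝B))))
      (λ { refl → d∈A }) (λ { refl → d∈B }))
    where
    sA′ = small-acl (small-∪ sA sC)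
    sB′ = small-acl (small-∪ sB sC)

  -- The base of the type over `acl M B` lies in `acl M C₁` and in `acl M C₂`, because independence
  -- persists over both. Base monotonicity enlarges it to their intersection.
  intersection : HasWeakCanonicalBases M _⫝⟨_⟩_ → ∀ {A B C₁ C₂} → Small M A → Small M B →
    C₁ ⊆ B → C₂ ⊆ B → A ⫝⟨ C₁ ⟩ B → A ⫝⟨ C₂ ⟩ B → A ⫝⟨ acl M C₁ ∩ acl M C₂ ⟩ B
  intersection hasBases {A} {B} {C₁} {C₂} sA sB C₁⊆B C₂⊆B A⫝₁ A⫝₂ =
    monotonicity (small-range EA.tuple) sclB (small-⊆ proj₁ (small-acl (small-⊆ C₁⊆B sB)))
      (baseMonotonicity (small-range EA.tuple) sclB
        (λ x∈ → smallest (acl-mono C₁⊆B) (closed (small-⊆ C₁⊆B sB)) (over C₁⊆B A⫝₁) x∈ ,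
                smallest (acl-mono C₂⊆B) (closed (small-⊆ C₂⊆B sB)) (over C₂⊆B A⫝₂) x∈)
        (λ (x∈ , _) → acl-mono C₁⊆B x∈) independent)
      EA.index ⊆-acl
    where
    module EA = Enumeration (enumerate sA)
    sclB = small-acl sB

    closed : Small M C → AclClosed M (acl M C)
    closed sC = ⊆-acl , acl-idempotent sC

    over : C ⊆ B → A ⫝⟨ C ⟩ B → range M EA.tuple ⫝⟨ acl M C ⟩ acl M B
    over C⊆B A⫝B = let sC = small-⊆ C⊆B sB in
      monotonicity sA sclB (small-acl sC)
        (baseMonotonicity sA sclB ⊆-acl (acl-mono C⊆B)
          (monotonicity sA (small-acl (small-∪ sB sC)) sC (acl-right sA sB sC A⫝B) id (acl-mono inj₁)))
        (λ { (j , refl) → EA.member j }) id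

    open IsWeakCanonicalBase (proj₂ (hasBases EA.tuple sclB (closed sB)))

  -- The algebraic kernel of a Morley sequence.

  module Morley {I : Set ℓ} {σ : I → Sort} (a : Tuple M σ) {B : Subset M} (sB : Small M B)
                (closedB : AclClosed M B) (as : ℕ → Tuple M σ) (morley : IsMorley M _⫝⟨_⟩_ a B as) where
    open IsMorley morley

    private
      conjugate : ∀ n → Σ (Automorphism M) λ α → Fixes α B × (∀ i → act α (a i) ≡ as n i)
      conjugate n = sameType⇒fixes (enumerate sB) (realises n)

      sE = small-Earlier as
      sR : ∀ n → Small M (range M (as n))
      sR n = small-range (as n)

    terms : Subset M
    terms x = ∃[ i ] x ∈ᴾ range M (as i)

    small-terms : Small M terms
    small-terms = (ℕ × I) , (λ (n , i) → σ i , as n i) , λ (n , i , e) → (n , i) , e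

    acl-terms : acl M terms ⊆ λ d → ∃[ n ] d ∈ᴾ acl M (Earlier as n)
    acl-terms d∈ = let xs , xs∈ , d∈xs = acl-finite d∈ ; n , h = bound xs∈ in
      n , acl-mono (All.lookup h) d∈xs
      where
      bound : ∀ {xs} → All (_∈ᴾ terms) xs → ∃[ n ] All (_∈ᴾ Earlier as n) xs
      bound [] = 0 , []
      bound ((m , x∈) ∷ hs) = let n , h = bound hs in suc m ℕ.⊔ n ,
        (m , m≤m⊔n (suc m) n , x∈) ∷ All.map (λ (k , k<n , y∈) → k , ≤-trans k<n (m≤n⊔m (suc m) n) , y∈) h

    -- The last term is conjugate to `a` over `B`. The terms before it are independent of it over
    -- `B` and, inductively, of `B` over `D`; by right transitivity they are independent of `B` over
    -- `D` and the last term.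
    earlier⫝ : D ⊆ B → range M a ⫝⟨ D ⟩ B → ∀ n → Earlier as n ⫝⟨ D ⟩ B
    earlier⫝ D⊆B a⫝B zero =
      monotonicity (small-range a) sB (small-⊆ D⊆B sB) a⫝B (λ { (_ , () , _) }) id
    earlier⫝ {D} D⊆B a⫝B (suc n) =
      monotonicity (small-∪ (sR n) (sE n)) sB sD
        (leftTransitivity sB sD (sR n) (sE n) asₙ⫝B
          (monotonicity (sE n) sBR (small-∪ sD (sR n))
            (enlargeBase (sE n) sBR sD inj₁ (Sum.[ inj₂ , (λ x∈ → inj₁ (inj₂ x∈)) ])
              (rightTransitivity (sE n) sBR sB sD D⊆B inj₁
                (monotonicity (sE n) (small-∪ (sR n) sB) sB
                  (addBase-right (sE n) (sR n) sB (independent n)) id Sum.swap)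
                (earlier⫝ D⊆B a⫝B n)))
            id inj₁))
        split id
      where
      sD = small-⊆ D⊆B sB
      sBR = small-∪ sB (sR n)
      asₙ⫝B : range M (as n) ⫝⟨ D ⟩ B
      asₙ⫝B = let α , fix , h = conjugate n in
        invariance (small-range a) sB sD α (mapsOnto-range α h) (fixes⇒mapsOnto α fix)
          (fixes⇒mapsOnto α λ d d∈ → fix d (D⊆B d∈)) a⫝B
      split : Earlier as (suc n) ⊆ range M (as n) ∪ Earlier as n
      split (m , m<1+n , x∈) with m≤n⇒m<n∨m≡n (ℕ.s≤s⁻¹ m<1+n)
      ... | inj₁ m<n  = inj₂ (m , m<n , x∈)
      ... | inj₂ refl = inj₁ x∈

    acl-terms⊆ : D ⊆ B → AclClosed M D → range M a ⫝⟨ D ⟩ B → B ∩ acl M terms ⊆ D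
    acl-terms⊆ D⊆B closedD a⫝B (d∈B , d∈) = let n , d∈ₙ = acl-terms d∈ in
      proj₂ closedD (acl-∩ (sE n) sB (small-⊆ D⊆B sB) (earlier⫝ D⊆B a⫝B n)
        (acl-mono inj₁ d∈ₙ , ⊆-acl (inj₁ d∈B)))

    Segment : ℕ → ℕ → Subset M
    Segment n m x = ∃[ i ] (n ≤ i × i < m) × x ∈ᴾ range M (as i)

    segment⊆ : ∀ {n m} → Segment n m ⊆ Earlier as m
    segment⊆ (i , (_ , i<m) , x∈) = i , i<m , x∈

    -- The segment grows by right transitivity. `Earlier as m` contains both the terms before `n`
    -- and the segment so far, so the latter can be moved into the base.
    earlier⫝segment : ∀ n m → Earlier as n ⫝⟨ B ⟩ Segment n m
    earlier⫝segment n zero =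
      monotonicity (sE n) (sR n) sB (independent n) id (λ { (_ , (_ , ()) , _) })
    earlier⫝segment n (suc m) with n ℕ.≤? m
    ... | no n≰m = monotonicity (sE n) (small-⊆ segment⊆ (sE m)) sB (earlier⫝segment n m) id
            λ (i , (n≤i , i<1+m) , _) → contradiction (≤-trans n≤i (ℕ.s≤s⁻¹ i<1+m)) n≰m
    ... | yes n≤m =
      monotonicity (sE n) (small-∪ (sR m) sBS) sB
        (rightTransitivity (sE n) (small-∪ (sR m) sBS) sBS sB inj₁ inj₂
          (addBase-right (sE n) (sR m) sBS
            (symmetry (sR m) (sE n) sBS
              (monotonicity (sR m) (sE m) sBS
                (enlargeBase (sR m) (sE m) sB inj₁ (Sum.[ inj₂ , (λ x∈ → inj₁ (segment⊆ x∈)) ])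
                  (symmetry (sE m) (sR m) sB (independent m)))
                id λ (i , i<n , x∈) → i , <-≤-trans i<n n≤m , x∈)))
          (monotonicity (sE n) (small-∪ sS sB) sB
            (addBase-right (sE n) sS sB (earlier⫝segment n m)) id Sum.swap))
        id split
      where
      sS = small-⊆ segment⊆ (sE m)
      sBS = small-∪ sB sS
      split : Segment n (suc m) ⊆ range M (as m) ∪ (B ∪ Segment n m)
      split (i , (n≤i , i<1+m) , x∈) with m≤n⇒m<n∨m≡n (ℕ.s≤s⁻¹ i<1+m)
      ... | inj₁ i<m  = inj₂ (inj₂ (i , (n≤i , i<m) , x∈))
      ... | inj₂ refl = inj₁ x∈

    aker⊆B : aker M as ⊆ B
    aker⊆B {d} (d∈ , ind) =
      let n , d∈ₙ = acl-terms d∈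
          -- Indiscernibility over `d` shifts the first `n` terms by `n`, past all of them, by an
          -- automorphism that fixes `d`.
          α , fix , h = sameType⇒fixes (enumerate (small-list (d ∷ [])))
            {x = concat M as {n} toℕ} {y = concat M as (λ k → n + toℕ k)}
            (sameType-⊆ (λ { (here e) → sym e }) (ind n toℕ (λ k → n + toℕ k) id (+-monoʳ-< n)))
          move : ∀ {x} → x ∈ᴾ Earlier as n → apply α x ∈ᴾ Segment n (n + n)
          move = λ { (k , k<n , i , refl) → n + k , (m≤m+n n k , +-monoʳ-< n k<n) , i ,
            cong (σ i ,_) (sym (subst (λ m → act α (as m i) ≡ as (n + m) i) (toℕ-fromℕ< k<n)
                                      (h (fromℕ< k<n , i)))) }
      in proj₂ closedB (acl-∩ (sE n) (small-⊆ segment⊆ (sE (n + n))) sB (earlier⫝segment n (n + n))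
           ( acl-mono inj₁ d∈ₙ
           , acl-mono inj₁ (subst (_∈ᴾ acl M (Segment n (n + n))) (fix d (here refl)) (acl-act α move d∈ₙ))))

    ⊆aker : B ∩ acl M terms ⊆ aker M as
    ⊆aker {d} (d∈B , d∈) = d∈ , λ n f g f< g< → sameType-⊆ (λ { refl → d∈B }) (indiscernible n f g f< g<)

    -- Being `B ∩ acl M terms`, the kernel is an intersection of closed sets.
    aker-closed : AclClosed M (aker M as)
    aker-closed = ⊆-acl , λ d∈ → ⊆aker
      (proj₂ closedB (acl-mono aker⊆B d∈) , acl-idempotent small-terms (acl-mono proj₁ d∈))

    module _ (intersects : ∀ {A B C₁ C₂} → Small M A → Small M B → C₁ ⊆ B → C₂ ⊆ B →
                A ⫝⟨ C₁ ⟩ B → A ⫝⟨ C₂ ⟩ B → A ⫝⟨ acl M C₁ ∩ acl M C₂ ⟩ B) where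
      open LongFamily sB

      private
        order : IsWeakOrder {K = Long} _<ᵣ_
        order = <ᵣ-isWeakOrder em
        module Str = Stretching em 𝕄 sB as indiscernible order

        c : Long → Tuple M σ
        c = Str.stretched

        -- `reflect` is given an empty base: independence is wanted over the members alone, to be
        -- intersected with independence over `B`.
        ∅ : Subset M
        ∅ _ = ⊥ₚ.⊥

        s∅ : Small M ∅
        s∅ = small-⊆ (λ ()) sB

        f = proj₁ (reflect c s∅)
        top : Long
        top = node branch f

        S : Subset M
        S = ∅ ∪ Members c f

        sS : Small M S
        sS = small-∪ s∅ (small-Members c f)

        members⫝top : Members c f ⫝⟨ B ⟩ range M (c top)
        members⫝top = members⫝ id sB as indiscernible order f {top} λ pos ps compat →
          monotonicity (sE (pos top)) (sR (pos top)) sB (independent (pos top))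
            (λ (p , p∈ , x∈) → pos (f p) ,
              to (compat (there (∈-map⁺ f p∈)) (here refl)) (p , ≤ᵣ-refl (f p)) , x∈)
            id

        top⫝ : range M (c top) ⫝⟨ acl M S ∩ acl M B ⟩ (S ∪ B)
        -- Both independences are brought to the right side `S ∪ B`, which contains both bases.
        top⫝ = intersects (small-range (c top)) (small-∪ sS sB) inj₁ inj₂
          (monotonicity (small-range (c top)) (small-∪ sB sS) sS
            (addBase-right (small-range (c top)) sB sS
              (symmetry sB (small-range (c top)) sS (proj₂ (reflect c s∅)))) id Sum.swap)
          (addBase-right (small-range (c top)) sS sB
            (monotonicity (small-range (c top)) (small-Members c f) sB
              (symmetry (small-Members c f) (small-range (c top)) sB members⫝top)
              id λ { (inj₂ x∈) → x∈ }))

        -- An element of `B` is fixed when finitely many members are aligned with terms of `as`, so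
        -- it is algebraic over those terms too.
        acl-members : acl M S ∩ acl M B ⊆ aker M as
        acl-members {d} (d∈S , d∈aclB) =
          let d∈B = proj₂ closedB d∈aclB
              xs , xs∈ , d∈xs = acl-finite d∈S
              ps , h = indices xs∈
              pos , _ , α , fix , e = Str.align ps
              move : ∀ {x} → x ∈ˡ xs → apply α x ∈ᴾ terms
              move x∈ = image α pos e (All.lookup h x∈)
          in ⊆aker (d∈B , subst (_∈ᴾ acl M terms) (fix d d∈B) (acl-act α move d∈xs))
          where
          indices : ∀ {xs} → All (_∈ᴾ S) xs → Σ (List Long) λ ks →
                    All (λ x → ∃[ k ] k ∈ˡ ks × x ∈ᴾ range M (c k)) xs
          indices [] = [] , []
          indices (inj₂ (p , x∈) ∷ hs) = let ks , h = indices hs in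
            f p ∷ ks , (f p , here refl , x∈) ∷ All.map (λ (k , k∈ , y∈) → k , there k∈ , y∈) h

          image : ∀ α (pos : Long → ℕ) {ks} → (∀ {k} → k ∈ˡ ks → ∀ i → act α (c k i) ≡ as (pos k) i) →
                  ∀ {x} → ∃[ k ] k ∈ˡ ks × x ∈ᴾ range M (c k) → apply α x ∈ᴾ terms
          image α pos e (k , k∈ , i , refl) = pos k , i , cong (σ i ,_) (sym (e k∈ i))

      a⫝aker : range M a ⫝⟨ aker M as ⟩ B
      a⫝aker =
        let δ , fix , h = Str.stretched-realises realises top
            sSB = small-∪ sS sB
        in invariance (small-range (c top)) sB (small-⊆ aker⊆B sB) δ
             (mapsOnto-range δ h) (fixes⇒mapsOnto δ fix) (fixes⇒mapsOnto δ λ d d∈ → fix d (aker⊆B d∈))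
             (monotonicity (small-range (c top)) sSB (small-⊆ aker⊆B sB)
               (baseMonotonicity (small-range (c top)) sSB acl-members (λ d∈ → inj₂ (aker⊆B d∈)) top⫝)
               id inj₂)

      aker-isBase : IsWeakCanonicalBase M _⫝⟨_⟩_ a B (aker M as)
      aker-isBase = record
        { subset = aker⊆B
        ; aclClosed = aker-closed
        ; independent = a⫝aker
        ; smallest = λ D⊆B closedD a⫝B d∈ →
            acl-terms⊆ D⊆B closedD a⫝B (aker⊆B d∈ , proj₁ d∈) }

  -- Extraction with `C` and `D` both equal to `B` makes each term free from its predecessors;
  -- symmetry turns this into the orientation of the definition.
  morleySequence : {I : Set ℓ} {σ : I → Sort} (a : Tuple M σ) {B : Subset M} → Small M B →
                   Σ (ℕ → Tuple M σ) (IsMorley M _⫝⟨_⟩_ a B)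
  morleySequence a {B} sB = sequence , record
    { indiscernible = sequence-indiscernible
    ; realises = λ n → proj₁ (sequence-free n)
    ; independent = λ n → symmetry (small-range (sequence n)) (small-Earlier sequence n) sB
        (monotonicity (small-range (sequence n)) (small-∪ sB (small-Earlier sequence n)) sB
          (proj₂ (sequence-free n)) id inj₂) }
    where open Extraction a {B} id sB (existence (small-range a) sB)

theorem3p20 :
    (∀ {a : Level} → ExcludedMiddle a) →
    ∀ {ℓ r : Level} (L : Signature ℓ) (T : Theory L) →
    Consistent T → Complete T → (𝕄 : BigModel T) →
    let M = BigModel.structure 𝕄 in
    (⫝ : Ternary M r) →
    (IsStrict M ⫝ → HasWeakCanonicalBases M ⫝ ⇔ IsCanonical M ⫝) ×
    (IsCanonical M ⫝ →
      ∀ {I : Set ℓ} {σ : I → Signature.Sort L} (a : Tuple M σ) {B : Subset M} →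
      Small M B → AclClosed M B →
      (as : ℕ → Tuple M σ) → IsMorley M ⫝ a B as →
      IsWeakCanonicalBase M ⫝ a B (aker M as))
theorem3p20 em {ℓ} {r} L T _ _ 𝕄 ⫝ = iff , base
  where
  M = BigModel.structure 𝕄

  base : IsCanonical M ⫝ → ∀ {I : Set ℓ} {σ : I → Signature.Sort L} (a : Tuple M σ) {B : Subset M} →
         Small M B → AclClosed M B → (as : ℕ → Tuple M σ) → IsMorley M ⫝ a B as →
         IsWeakCanonicalBase M ⫝ a B (aker M as)
  base canonical a sB closedB as morley =
    WeakCanonicalBases.Morley.aker-isBase em 𝕄 ⫝ (IsCanonical.isStrict canonical)
      a sB closedB as morley (IsCanonical.intersection canonical)

  bases⇒canonical : IsStrict M ⫝ → HasWeakCanonicalBases M ⫝ → IsCanonical M ⫝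
  bases⇒canonical strict hasBases = record
    { isStrict = strict
    ; intersection = WeakCanonicalBases.intersection em 𝕄 ⫝ strict (λ {I} {σ} → hasBases {I} {σ}) }

  canonical⇒bases : IsStrict M ⫝ → IsCanonical M ⫝ → HasWeakCanonicalBases M ⫝
  canonical⇒bases strict canonical a sB closedB =
    let as , morley = WeakCanonicalBases.morleySequence em 𝕄 ⫝ strict a sB
    in aker M as , base canonical a sB closedB as morley

  iff : IsStrict M ⫝ → HasWeakCanonicalBases M ⫝ ⇔ IsCanonical M ⫝
  iff strict = mk⇔ (λ h → bases⇒canonical strict (λ {I} {σ} → h {I} {σ}))
                   (λ c {I} {σ} → canonical⇒bases strict c {I} {σ})
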